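{- Let $\alpha$ be a set with an involution $\tau:\alpha\to\alpha$, and let $\mathcal N_c=\mathcal N_c(\alpha,\tau)$ be the group of cobordism classes of nanowords over $\alpha$. If $\tau$ has at least two orbits, then $\mathcal N_c$ is infinite. If $\tau$ has at least two orbits and $\tau\ne\mathrm{id}$, then $\mathcal N_c$ is infinitely generated (i.e. not finitely generated). If $\tau$ has at least three orbits, or $\tau$ has two orbits and $\tau\neq\mathrm{id}$, then $\mathcal N_c$ is non-abelian.
   Context: **Nanowords.** $\alpha$ is a set with an involution $\tau:\alpha\to\alpha$ ($\tau^2=\mathrm{id}$; fixed points allowed). An $\alpha$-alphabet is a set $\mathcal A$ with a map $\mathcal A\to\alpha$, $A\mapsto|A|$. A nanoword of length $n$ over $\alpha$ is a pair $(\mathcal A,w)$ with $\mathcal A$ an $\alpha$-alphabet and $w:\{1,\dots,n\}\to\mathcal A$ a map (written as the sequence $w(1)\cdots w(n)$) taking every value in $\mathcal A$ exactly twice; there is a unique empty nanoword $\emptyset$. Nanowords $(\mathcal A,w),(\mathcal A',w')$ are isomorphic if $w'=fw$ for a bijection $f:\mathcal A\to\mathcal A'$ with $|f(A)|=|A|$. The opposite word of $w$ is $w^-=w(n)\cdots w(1)$. The product of two nanowords is their concatenation, after making the alphabets disjoint by an isomorphism. **Homotopy moves.** (1) $(\mathcal A,xAAy)\mapsto(\mathcal A-\{A\},xy)$; (2) $(\mathcal A,xAByBAz)\mapsto(\mathcal A-\{A,B\},xyz)$ if $|B|=\tau(|A|)$; (3) $(\mathcal A,xAByACzBCt)\mapsto(\mathcal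 A,xBAyCAzCBt)$ for distinct $A,B,C$ with $|A|=|B|=|C|$. **Surgery.** A nanophrase $\nabla=(\mathcal B,(v_1|\cdots|v_k))$ is a sequence of words in an $\alpha$-alphabet $\mathcal B$ such that every letter of $\mathcal B$ appears exactly twice in $v_1v_2\cdots v_k$. Put $\varepsilon_\nabla(B)=0$ if both occurrences of $B$ are in the same $v_r$, and $\varepsilon_\nabla(B)=1$ otherwise. $\nabla$ is even if all $v_r$ have even length; it is symmetric if there is a bijection $\iota:\mathcal B\to\mathcal B$ with $\iota v_r=v_r^-$ for all $r$ and $|\iota(B)|=\tau^{\varepsilon_\nabla(B)}(|B|)$ for all $B$. $\nabla$ is a factor of a nanoword $(\mathcal A,w)$ if $\mathcal B\subset\mathcal A$ (with restricted projection to $\alpha$) and $w=x_1v_1x_2v_2\cdots x_kv_kx_{k+1}$ with $x_i$ words in $\mathcal A-\mathcal B$. A surgery replaces $(\mathcal A,w)$ by $(\mathcal A-\mathcal B,x_1x_2\cdots x_{k+1})$, where $\nabla$ is an even symmetric factor. **Cobordism.** Two nanowords are cobordant if they are related by a finite sequence of isomorphisms, homotopy moves, surgeries and inverse moves. The cobordism classes form a group $\mathcal N_c=\mathcal N_c(\alpha,\tau)$ under concatenation, with unit the class of $\emptyset$ and inverse of $w$ given by $w^-$. -}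

module Defs where

open import Level using (Level; _⊔_; 0ℓ) renaming (suc to lsuc)
open import Algebra.Bundles using (Group)
open import Algebra.Definitions using (Involutive)
open import Data.Empty using (⊥)
open import Data.Fin.Base using (Fin; zero; suc)
open import Data.Fin.Properties using () renaming (_≟_ to _≟ᶠ_)
open import Data.List.Base using (List; []; _∷_; _++_; map; concat; reverse; length)
open import Data.List.Membership.Propositional using (_∈_)
open import Data.List.Properties
  using (map-++; map-∘; map-id; ++-assoc; ++-identityʳ; length-++;
         length-map; length-reverse; reverse-++; reverse-map; reverse-involutive)
open import Data.List.Relation.Binary.BagAndSetEquality using (↭⇒∼bag)
open import Data.List.Relation.Binary.Permutation.Propositional.Properties using (↭-reverse)
open import Data.List.Relation.Unary.All using (All; []; _∷_)
open import Data.List.Relation.Unary.Any using (Any; index)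
open import Data.List.Relation.Unary.Any.Properties using (concat⁻; ++↔; map↔; Any-cong; ⊥↔Any⊥)
open import Data.Nat.Base using (ℕ; suc; _+_; _*_)
open import Data.Nat.Divisibility using (_∣_; divides)
open import Data.Nat.GeneralisedArithmetic using (fold)
open import Data.Nat.Properties using (*-comm; +-identityʳ)
open import Data.Product.Base using (_,_; ∃-syntax; Σ-syntax; proj₁; proj₂)
open import Data.Sum.Base using (_⊎_; inj₁; inj₂; [_,_]′; swap)
open import Data.Sum.Function.Propositional using (_⊎-cong_)
open import Data.Sum.Properties using (inj₁-injective; inj₂-injective)
open import Data.Unit.Base using (⊤; tt)
open import Data.Vec.Base using (Vec; []; _∷_; toList)
open import Function.Base using (_∘_; id; const)
open import Function.Bundles using (_↔_; Inverse; Injection; Bijection; mk↔ₛ′)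
open import Function.Properties.Inverse using (↔-refl; ↔-sym; ↔-trans)
open import Function.Related.TypeIsomorphisms using (⊎-assoc; ⊎-comm)
open import Relation.Binary.Bundles using (Setoid)
open import Relation.Binary.Construct.Closure.Equivalence as EqC using (EqClosure)
open import Relation.Binary.Construct.Closure.ReflexiveTransitive using (_◅◅_)
open import Relation.Binary.PropositionalEquality
  using (_≡_; _≢_; refl; sym; trans; cong; cong₂; subst; setoid; module ≡-Reasoning)
open import Relation.Nullary.Decidable using (yes; no)
open import Relation.Nullary.Negation using (¬_; contradiction)

private
  variable
    a c ℓ : Level

------------------------------------------------------------------------
-- Orbits of an involution

module _ {α : Set a} (τ : α → α) (τ-involutive : Involutive _≡_ τ) where

  SameOrbit : α → α → Set a
  SameOrbit x y = y ≡ x ⊎ y ≡ τ x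

  Orbits : Setoid a a
  Orbits = record
    { _≈_           = SameOrbit
    ; isEquivalence = record
      { refl  = inj₁ refl
      ; sym   = λ { (inj₁ refl) → inj₁ refl
                  ; (inj₂ refl) → inj₂ (sym (τ-involutive _)) }
      ; trans = λ { (inj₁ refl) q           → q
                  ; (inj₂ refl) (inj₁ refl) → inj₂ refl
                  ; (inj₂ refl) (inj₂ refl) → inj₁ (τ-involutive _) }
      }
    }

  AtLeastOrbits : ℕ → Set a
  AtLeastOrbits n = Injection (setoid (Fin n)) Orbits

  ExactlyOrbits : ℕ → Set a
  ExactlyOrbits n = Bijection (setoid (Fin n)) Orbits

------------------------------------------------------------------------
-- Infinite and finitely generated groups

-- Infinitude in its positive form; it implies non-finiteness.
Infinite : Setoid c ℓ → Set (c ⊔ ℓ)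
Infinite S = Injection (setoid ℕ) S

module _ (G : Group c ℓ) where
  open Group G renaming (ε to 1#)

  data ⟨_⟩ {n} (g : Fin n → Carrier) : Carrier → Set (c ⊔ ℓ) where
    gen  : ∀ i → ⟨ g ⟩ (g i)
    unit : ⟨ g ⟩ 1#
    mul  : ∀ {x y} → ⟨ g ⟩ x → ⟨ g ⟩ y → ⟨ g ⟩ (x ∙ y)
    inv  : ∀ {x} → ⟨ g ⟩ x → ⟨ g ⟩ (x ⁻¹)
    resp : ∀ {x y} → x ≈ y → ⟨ g ⟩ x → ⟨ g ⟩ y

  FinitelyGenerated : Set (c ⊔ ℓ)
  FinitelyGenerated = ∃[ n ] Σ[ g ∈ (Fin n → Carrier) ] ∀ x → ⟨ g ⟩ x

  -- Non-commutativity in its positive form; it implies that G is not abelian.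
  NonAbelian : Set (c ⊔ ℓ)
  NonAbelian = ∃[ x ] ∃[ y ] (¬ (x ∙ y) ≈ (y ∙ x))

------------------------------------------------------------------------
-- Words

-- The type A ∈ w is the set of occurrences of A in w, i.e. the fibre over A of
-- the map {1,…,n} → X given by w.
Twice : {X : Set} → List X → Set
Twice w = ∀ A → (A ∈ w) ↔ Fin 2

-- For phrases v₁|⋯|vₖ in B and gaps x₁,…,xₖ₊₁ in C: the word x₁v₁⋯xₖvₖxₖ₊₁.
interleave : {C B : Set} (vs : List (List B)) → Vec (List C) (suc (length vs)) → List (C ⊎ B)
interleave []       (x ∷ []) = map inj₁ x
interleave (v ∷ vs) (x ∷ xs) = map inj₁ x ++ map inj₂ v ++ interleave vs xs

------------------------------------------------------------------------
-- Nanowords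

module Nanowords {α : Set a} (τ : α → α) where

  -- The alphabets carrying nanowords are finite, so small types suffice.
  record Alphabet : Set (lsuc 0ℓ ⊔ a) where
    field
      Letter : Set
      ∣_∣    : Letter → α

  open Alphabet public using (Letter)
  open Alphabet using () renaming (∣_∣ to label)

  record Nanoword : Set (lsuc 0ℓ ⊔ a) where
    constructor nanoword
    field
      alphabet : Alphabet
      word     : List (Letter alphabet)
      twice    : Twice word

  ∅ᵃ : Alphabet
  ∅ᵃ = record { Letter = ⊥ ; ∣_∣ = λ () }

  ⟨_⟩ᵃ : α → Alphabet
  ⟨ a ⟩ᵃ = record { Letter = ⊤ ; ∣_∣ = const a }

  infixr 5 _⊕_

  _⊕_ : Alphabet → Alphabet → Alphabet
  𝒜 ⊕ ℬ = record { Letter = Letter 𝒜 ⊎ Letter ℬ ; ∣_∣ = [ label 𝒜 , label ℬ ]′ }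

  record Nanophrase : Set (lsuc 0ℓ ⊔ a) where
    constructor nanophrase
    field
      alphabet : Alphabet
      words    : List (List (Letter alphabet))
      twice    : Twice (concat words)

    open Inverse using (from)

    -- The index r of the word vᵣ containing the i-th occurrence of B.
    position : Letter alphabet → Fin 2 → Fin (length words)
    position B i = index (concat⁻ words (from (twice B) i))

    ε∇ : Letter alphabet → ℕ
    ε∇ B with position B zero ≟ᶠ position B (suc zero)
    ... | yes _ = 0
    ... | no  _ = 1

    Even : Set
    Even = All (λ v → 2 ∣ length v) words

    record Symmetric : Set a where
      field
        ι       : Letter alphabet ↔ Letter alphabet
      open Inverse ι using (to)
      field
        reverses : All (λ v → map to v ≡ reverse v) words
        label-ι  : ∀ B → label alphabet (to B) ≡ fold (label alphabet B) τ (ε∇ B)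

  module ∇ = Nanophrase

  open Nanoword public

  record _≅_ (u v : Nanoword) : Set a where
    constructor iso
    field
      bijection : Letter (alphabet u) ↔ Letter (alphabet v)
    open Inverse bijection using (to)
    field
      label-to  : ∀ A → label (alphabet v) (to A) ≡ label (alphabet u) A
      word-to   : map to (word u) ≡ word v

  -- Isomorphisms being among the steps, a nanoword whose alphabet 𝒜 contains ℬ
  -- may be taken to have alphabet 𝒞 ⊕ ℬ, where 𝒞 plays the role of 𝒜 − ℬ.
  -- That the words on either side of a move satisfy Twice is an equivalent
  -- condition on the two sides; each step takes both proofs as arguments.
  data Step : Nanoword → Nanoword → Set (lsuc 0ℓ ⊔ a) where

    isomorphism : ∀ {u v} → u ≅ v → Step u v

    move₁ : ∀ {𝒞} a x y →
      let A = inj₂ tt in ∀ {p q} →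
      Step (nanoword (𝒞 ⊕ ⟨ a ⟩ᵃ) (map inj₁ x ++ A ∷ A ∷ map inj₁ y) p)
           (nanoword 𝒞 (x ++ y) q)

    move₂ : ∀ {𝒞} a b x y z → b ≡ τ a →
      let A = inj₂ (inj₁ tt) ; B = inj₂ (inj₂ tt) in ∀ {p q} →
      Step (nanoword (𝒞 ⊕ ⟨ a ⟩ᵃ ⊕ ⟨ b ⟩ᵃ)
                     (map inj₁ x ++ A ∷ B ∷ map inj₁ y ++ B ∷ A ∷ map inj₁ z) p)
           (nanoword 𝒞 (x ++ y ++ z) q)

    move₃ : ∀ {𝒜} A B C x y z t → A ≢ B → B ≢ C → A ≢ C →
      label 𝒜 A ≡ label 𝒜 B → label 𝒜 B ≡ label 𝒜 C → ∀ {p q} →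
      Step (nanoword 𝒜 (x ++ A ∷ B ∷ y ++ A ∷ C ∷ z ++ B ∷ C ∷ t) p)
           (nanoword 𝒜 (x ++ B ∷ A ∷ y ++ C ∷ A ∷ z ++ C ∷ B ∷ t) q)

    surgery : ∀ {𝒞} (∇ : Nanophrase) xs → ∇.Even ∇ → ∇.Symmetric ∇ → ∀ {p q} →
      Step (nanoword (𝒞 ⊕ ∇.alphabet ∇) (interleave (∇.words ∇) xs) p)
           (nanoword 𝒞 (concat (toList xs)) q)

  infix 4 _∼_

  _∼_ : Nanoword → Nanoword → Set (lsuc 0ℓ ⊔ a)
  _∼_ = EqClosure Step

  ----------------------------------------------------------------------
  -- Concatenation and opposite

  ⊥⊎↔ : {X : Set} → (⊥ ⊎ X) ↔ X
  ⊥⊎↔ = mk↔ₛ′ [ (λ ()) , id ]′ inj₂ (λ _ → refl) (λ { (inj₁ ()) ; (inj₂ _) → refl })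

  ⊎⊥↔ : {X : Set} → (X ⊎ ⊥) ↔ X
  ⊎⊥↔ = mk↔ₛ′ [ id , (λ ()) ]′ inj₁ (λ _ → refl) (λ { (inj₁ _) → refl ; (inj₂ ()) })

  Any≡ : {X Y : Set} {f : X → Y} {A : X} {B : Y} (w : List X) →
         (∀ x → (A ≡ x) ↔ (B ≡ f x)) → (A ∈ w) ↔ (B ∈ map f w)
  Any≡ w e = ↔-trans (Any-cong e ↔-refl) map↔

  ∈₁ : {X Y : Set} {A : X} (w : List X) → (A ∈ w) ↔ (inj₁ {B = Y} A ∈ map inj₁ w)
  ∈₁ w = Any≡ w λ _ → mk↔ₛ′ (cong inj₁) inj₁-injective (λ { refl → refl }) (λ { refl → refl })

  ∈₂ : {X Y : Set} {A : Y} (w : List Y) → (A ∈ w) ↔ (inj₂ {A = X} A ∈ map inj₂ w)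
  ∈₂ w = Any≡ w λ _ → mk↔ₛ′ (cong inj₂) inj₂-injective (λ { refl → refl }) (λ { refl → refl })

  ∉₁ : {X Y : Set} {A : Y} (w : List X) → ⊥ ↔ (inj₂ A ∈ map inj₁ w)
  ∉₁ w = ↔-trans ⊥↔Any⊥
           (↔-trans (Any-cong (λ _ → mk↔ₛ′ (λ ()) (λ ()) (λ ()) (λ ())) ↔-refl) map↔)

  ∉₂ : {X Y : Set} {A : X} (w : List Y) → ⊥ ↔ (inj₁ A ∈ map inj₂ w)
  ∉₂ w = ↔-trans ⊥↔Any⊥
           (↔-trans (Any-cong (λ _ → mk↔ₛ′ (λ ()) (λ ()) (λ ()) (λ ())) ↔-refl) map↔)

  -- The word l w r, with w and lr in disjoint alphabets.
  _[_]_ : {X Y : Set} → List Y → List X → List Y → List (X ⊎ Y)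
  l [ w ] r = map inj₂ l ++ map inj₁ w ++ map inj₂ r

  twice-[] : {X Y : Set} (w : List X) (l r : List Y) →
             Twice w → Twice (l ++ r) → Twice (l [ w ] r)
  twice-[] w l r p q (inj₁ A) =
    ↔-trans (↔-sym ++↔)
    (↔-trans (↔-sym (∉₂ l) ⊎-cong ↔-trans (↔-sym ++↔) (↔-sym (∈₁ w) ⊎-cong ↔-sym (∉₂ r)))
    (↔-trans ⊥⊎↔ (↔-trans ⊎⊥↔ (p A))))
  twice-[] w l r p q (inj₂ A) =
    ↔-trans (↔-sym ++↔)
    (↔-trans (↔-sym (∈₂ l) ⊎-cong ↔-trans (↔-sym ++↔) (↔-sym (∉₁ w) ⊎-cong ↔-sym (∈₂ r)))
    (↔-trans (↔-refl ⊎-cong ⊥⊎↔) (↔-trans ++↔ (q A))))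

  twice-map : {X Y : Set} (f : X ↔ Y) {w : List X} → Twice w → Twice (map (Inverse.to f) w)
  twice-map f {w} p B = ↔-trans (↔-sym (Any≡ w e)) (p (from B))
    where
    open Inverse f
    e : ∀ x → (from B ≡ x) ↔ (B ≡ to x)
    e x = mk↔ₛ′ (λ { refl → sym (strictlyInverseˡ B) })
                (λ { refl → strictlyInverseʳ x })
                (λ { refl → uip _ _ }) (λ { refl → uip _ _ })
      where
      uip : {Z : Set} {x y : Z} (p q : x ≡ y) → p ≡ q
      uip refl refl = refl

  twice-reverse : {X : Set} {w : List X} → Twice w → Twice (reverse w)
  twice-reverse {w = w} p A = ↔-trans (↭⇒∼bag (↭-reverse w)) (p A)

  ∅ : Nanoword
  ∅ = nanoword ∅ᵃ [] λ ()

  infixl 7 _·_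
  infix  8 _⁻

  _·_ : Nanoword → Nanoword → Nanoword
  u · v = nanoword (alphabet u ⊕ alphabet v) (map inj₁ (word u) ++ map inj₂ (word v))
                   (twice-[] (word u) [] (word v) (twice u) (twice v))

  _⁻ : Nanoword → Nanoword
  u ⁻ = nanoword (alphabet u) (reverse (word u)) (twice-reverse (twice u))

  ----------------------------------------------------------------------
  -- The group of cobordism classes

  step : ∀ {u v} → Step u v → u ∼ v
  step = EqC.return

  ∼-sym : ∀ {u v} → u ∼ v → v ∼ u
  ∼-sym = EqC.symmetric Step

  ≅⇒∼ : ∀ {u v} → u ≅ v → u ∼ v
  ≅⇒∼ e = step (isomorphism e)

  word≡ : ∀ {𝒜 w w′ p p′} → w ≡ w′ → nanoword 𝒜 w p ∼ nanoword 𝒜 w′ p′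
  word≡ {w = w} eq = ≅⇒∼ (iso ↔-refl (λ _ → refl) (trans (map-id w) eq))

  relabel : ∀ u {ℬ} (f : Letter (alphabet u) ↔ Letter ℬ) →
            (∀ A → label ℬ (Inverse.to f A) ≡ label (alphabet u) A) →
            ∀ {w} → map (Inverse.to f) (word u) ≡ w → ∃[ p ] (u ∼ nanoword ℬ w p)
  relabel u f lab eq =
    subst Twice eq (twice-map f (twice u)) , ≅⇒∼ (iso f lab eq)

  module _ {X Y Z : Set} (f : X ⊎ Y → Z) where

    map-[] : ∀ (w : List X) (l r : List Y) →
      map f (l [ w ] r) ≡ map (f ∘ inj₂) l ++ map (f ∘ inj₁) w ++ map (f ∘ inj₂) r
    map-[] w l r = begin
      map f (map inj₂ l ++ map inj₁ w ++ map inj₂ r)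
        ≡⟨ map-++ f (map inj₂ l) _ ⟩
      map f (map inj₂ l) ++ map f (map inj₁ w ++ map inj₂ r)
        ≡⟨ cong₂ _++_ (sym (map-∘ l)) (map-++ f (map inj₁ w) _) ⟩
      map (f ∘ inj₂) l ++ map f (map inj₁ w) ++ map f (map inj₂ r)
        ≡⟨ cong (map (f ∘ inj₂) l ++_) (cong₂ _++_ (sym (map-∘ w)) (sym (map-∘ r))) ⟩
      map (f ∘ inj₂) l ++ map (f ∘ inj₁) w ++ map (f ∘ inj₂) r ∎
      where open ≡-Reasoning

  assocʳ : {X Y Z : Set} → ((X ⊎ Y) ⊎ Z) ↔ ((X ⊎ Z) ⊎ Y)
  assocʳ = mk↔ₛ′ f f ff ff
    where
    f : ∀ {X Y Z : Set} → (X ⊎ Y) ⊎ Z → (X ⊎ Z) ⊎ Y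
    f (inj₁ (inj₁ x)) = inj₁ (inj₁ x)
    f (inj₁ (inj₂ y)) = inj₂ y
    f (inj₂ z)        = inj₁ (inj₂ z)
    ff : ∀ {X Y Z : Set} (x : (X ⊎ Y) ⊎ Z) → f (f x) ≡ x
    ff (inj₁ (inj₁ x)) = refl
    ff (inj₁ (inj₂ y)) = refl
    ff (inj₂ z)        = refl

  module _ {C B V : Set} where

    extend : (vs : List (List B)) (l r : List (C ⊎ V)) →
             Vec (List C) (suc (length vs)) → Vec (List (C ⊎ V)) (suc (length vs))
    extend []       l r (x ∷ []) = (l ++ map inj₁ x ++ r) ∷ []
    extend (v ∷ vs) l r (x ∷ xs) = (l ++ map inj₁ x) ∷ extend vs [] r xs

    concat-extend : ∀ vs l r xs →
      concat (toList (extend vs l r xs)) ≡ l ++ map inj₁ (concat (toList xs)) ++ r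
    concat-extend [] l r (x ∷ []) = begin
      (l ++ map inj₁ x ++ r) ++ []         ≡⟨ ++-identityʳ _ ⟩
      l ++ map inj₁ x ++ r                 ≡⟨ cong (λ s → l ++ map inj₁ s ++ r) (++-identityʳ x) ⟨
      l ++ map inj₁ (x ++ []) ++ r         ∎
      where open ≡-Reasoning
    concat-extend (v ∷ vs) l r (x ∷ xs) = begin
      (l ++ map inj₁ x) ++ concat (toList (extend vs [] r xs))
        ≡⟨ cong ((l ++ map inj₁ x) ++_) (concat-extend vs [] r xs) ⟩
      (l ++ map inj₁ x) ++ map inj₁ X ++ r
        ≡⟨ ++-assoc l _ _ ⟩
      l ++ map inj₁ x ++ map inj₁ X ++ r
        ≡⟨ cong (l ++_) (sym (++-assoc (map inj₁ x) _ _)) ⟩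
      l ++ (map inj₁ x ++ map inj₁ X) ++ r
        ≡⟨ cong (λ s → l ++ s ++ r) (map-++ inj₁ x X) ⟨
      l ++ map inj₁ (x ++ X) ++ r ∎
      where
      open ≡-Reasoning
      X = concat (toList xs)

    interleave-extend : ∀ vs l r xs →
      interleave vs (extend vs l r xs)
        ≡ map inj₁ l ++ map (Inverse.to assocʳ ∘ inj₁) (interleave vs xs) ++ map inj₁ r
    interleave-extend [] l r (x ∷ []) = begin
      map inj₁ (l ++ map inj₁ x ++ r)
        ≡⟨ map-++ inj₁ l _ ⟩
      map inj₁ l ++ map inj₁ (map inj₁ x ++ r)
        ≡⟨ cong (map inj₁ l ++_) (map-++ inj₁ (map inj₁ x) r) ⟩
      map inj₁ l ++ map inj₁ (map inj₁ x) ++ map inj₁ r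
        ≡⟨ cong (λ s → map inj₁ l ++ s ++ map inj₁ r) (trans (sym (map-∘ x)) (map-∘ x)) ⟩
      map inj₁ l ++ map (Inverse.to assocʳ ∘ inj₁) (map inj₁ x) ++ map inj₁ r ∎
      where open ≡-Reasoning
    interleave-extend (v ∷ vs) l r (x ∷ xs) = begin
      map inj₁ (l ++ map inj₁ x) ++ map inj₂ v ++ interleave vs (extend vs [] r xs)
        ≡⟨ cong₂ _++_ (map-++ inj₁ l _)
                      (cong (map inj₂ v ++_) (interleave-extend vs [] r xs)) ⟩
      (map inj₁ l ++ map inj₁ (map inj₁ x)) ++ map inj₂ v ++ map g I ++ map inj₁ r
        ≡⟨ ++-assoc (map inj₁ l) _ _ ⟩
      map inj₁ l ++ map inj₁ (map inj₁ x) ++ map inj₂ v ++ map g I ++ map inj₁ r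
        ≡⟨ cong (map inj₁ l ++_)
             (cong₂ _++_ (trans (sym (map-∘ x)) (map-∘ x))
                         (cong (_++ map g I ++ map inj₁ r) (map-∘ v))) ⟩
      map inj₁ l ++ map g (map inj₁ x) ++ map g (map inj₂ v) ++ map g I ++ map inj₁ r
        ≡⟨ cong (λ s → map inj₁ l ++ map g (map inj₁ x) ++ s)
             (trans (sym (++-assoc (map g (map inj₂ v)) _ _))
                    (cong (_++ map inj₁ r) (sym (map-++ g (map inj₂ v) I)))) ⟩
      map inj₁ l ++ map g (map inj₁ x) ++ map g (map inj₂ v ++ I) ++ map inj₁ r
        ≡⟨ cong (map inj₁ l ++_)
             (trans (sym (++-assoc (map g (map inj₁ x)) _ _))
                    (cong (_++ map inj₁ r) (sym (map-++ g (map inj₁ x) _)))) ⟩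
      map inj₁ l ++ map g (map inj₁ x ++ map inj₂ v ++ I) ++ map inj₁ r ∎
      where
      open ≡-Reasoning
      g = Inverse.to assocʳ ∘ inj₁
      I = interleave vs xs

  -- Inserting a nanoword between two words l and r.
  module Context (𝒱 : Alphabet) (l r : List (Letter 𝒱)) (lr : Twice (l ++ r)) where

    ctx : Nanoword → Nanoword
    ctx u = nanoword (alphabet u ⊕ 𝒱) (l [ word u ] r) (twice-[] (word u) l r (twice u) lr)

    ctx-≅ : ∀ {u v} → u ≅ v → ctx u ≅ ctx v
    ctx-≅ {u} {v} (iso f lab eq) = iso (f ⊎-cong ↔-refl)
      (λ { (inj₁ A) → lab A ; (inj₂ A) → refl })
      (trans (map-[] _ (word u) l r)
             (cong (λ s → map inj₂ l ++ s ++ map inj₂ r)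
                   (trans (map-∘ (word u)) (cong (map inj₁) eq))))

    ctx-removal : ∀ {ℬ} (vs : List (List (Letter ℬ))) →
      (∀ {𝒞} (xs : Vec (List (Letter 𝒞)) (suc (length vs))) {p q} →
        nanoword (𝒞 ⊕ ℬ) (interleave vs xs) p ∼ nanoword 𝒞 (concat (toList xs)) q) →
      ∀ {𝒞} (xs : Vec (List (Letter 𝒞)) (suc (length vs))) {p q} →
        ctx (nanoword (𝒞 ⊕ ℬ) (interleave vs xs) p) ∼ ctx (nanoword 𝒞 (concat (toList xs)) q)
    ctx-removal {ℬ} vs remove {𝒞} xs {p} {q} =
      proj₂ moved ◅◅ remove {𝒞 ⊕ 𝒱} xs′ {q = q′} ◅◅ word≡ eq
      where
      xs′ = extend vs (map inj₂ l) (map inj₂ r) xs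
      eq  = concat-extend vs (map inj₂ l) (map inj₂ r) xs
      q′  = subst Twice (sym eq) (twice-[] _ l r q lr)
      moved = relabel (ctx (nanoword (𝒞 ⊕ ℬ) (interleave vs xs) p)) {(𝒞 ⊕ 𝒱) ⊕ ℬ} assocʳ
        (λ { (inj₁ (inj₁ A)) → refl ; (inj₁ (inj₂ A)) → refl ; (inj₂ A) → refl })
        (trans (map-[] (Inverse.to assocʳ) (interleave vs xs) l r)
          (trans (cong₂ (λ s t → s ++ map (Inverse.to assocʳ ∘ inj₁) (interleave vs xs) ++ t)
                        (map-∘ l) (map-∘ r))
                 (sym (interleave-extend vs (map inj₂ l) (map inj₂ r) xs))))

    hex : ∀ {X : Set} (x y z t : List X) A B C D E F →
      l [ x ++ A ∷ B ∷ y ++ C ∷ D ∷ z ++ E ∷ F ∷ t ] r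
        ≡ (map inj₂ l ++ map inj₁ x) ++ inj₁ A ∷ inj₁ B ∷ map inj₁ y ++ inj₁ C ∷ inj₁ D ∷
          map inj₁ z ++ inj₁ E ∷ inj₁ F ∷ (map inj₁ t ++ map inj₂ r)
    hex x y z t A B C D E F =
      trans (cong (map inj₂ l ++_) (part x
        (cong (λ s → inj₁ A ∷ inj₁ B ∷ s) (part y
          (cong (λ s → inj₁ C ∷ inj₁ D ∷ s) (part z refl))))))
        (sym (++-assoc (map inj₂ l) _ _))
      where
      part : ∀ s {s′ s″} → map inj₁ s′ ++ map inj₂ r ≡ s″ →
             map inj₁ (s ++ s′) ++ map inj₂ r ≡ map inj₁ s ++ s″
      part s {s′} e = trans (cong (_++ map inj₂ r) (map-++ inj₁ s s′))
                        (trans (++-assoc (map inj₁ s) _ _) (cong (map inj₁ s ++_) e))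

    ctx-step : ∀ {u v} → Step u v → ctx u ∼ ctx v
    ctx-step (isomorphism e) = ≅⇒∼ (ctx-≅ e)
    ctx-step {u} {v} (move₁ {𝒞} a x y {p} {q}) =
      ctx-removal ((tt ∷ tt ∷ []) ∷ [])
        (λ { (x ∷ y ∷ []) {q = q} →
           let eq = cong (x ++_) (++-identityʳ y) in
           step (move₁ a x y {q = subst Twice eq q}) ◅◅ word≡ (sym eq) })
        (x ∷ y ∷ []) {q = subst Twice (sym eq₀) q}
      ◅◅ ≅⇒∼ (ctx-≅ {u = nanoword 𝒞 _ (subst Twice (sym eq₀) q)} {v}
                (iso ↔-refl (λ _ → refl) (trans (map-id _) eq₀)))
      where eq₀ = cong (x ++_) (++-identityʳ y)
    ctx-step {u} {v} (move₂ {𝒞} a b x y z b≡τa {p} {q}) =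
      ctx-removal ((inj₁ tt ∷ inj₂ tt ∷ []) ∷ (inj₂ tt ∷ inj₁ tt ∷ []) ∷ [])
        (λ { (x ∷ y ∷ z ∷ []) {q = q} →
           let eq = cong (λ s → x ++ y ++ s) (++-identityʳ z) in
           step (move₂ a b x y z b≡τa {q = subst Twice eq q}) ◅◅ word≡ (sym eq) })
        (x ∷ y ∷ z ∷ []) {q = subst Twice (sym eq₀) q}
      ◅◅ ≅⇒∼ (ctx-≅ {u = nanoword 𝒞 _ (subst Twice (sym eq₀) q)} {v}
                (iso ↔-refl (λ _ → refl) (trans (map-id _) eq₀)))
      where eq₀ = cong (λ s → x ++ y ++ s) (++-identityʳ z)
    ctx-step {u} {v} (move₃ A B C x y z t A≢B B≢C A≢C ab bc) =
      word≡ e₁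
      ◅◅ step (move₃ (inj₁ A) (inj₁ B) (inj₁ C) _ _ _ _
                 (A≢B ∘ inj₁-injective) (B≢C ∘ inj₁-injective) (A≢C ∘ inj₁-injective) ab bc
                 {p = subst Twice e₁ (twice (ctx u))} {q = subst Twice e₂ (twice (ctx v))})
      ◅◅ word≡ (sym e₂)
      where
      e₁ = hex x y z t A B A C B C
      e₂ = hex x y z t B A C A C B
    ctx-step (surgery ∇ xs even sy) =
      ctx-removal (∇.words ∇) (λ xs → step (surgery ∇ xs even sy)) xs

    ctx-cong : ∀ {u v} → u ∼ v → ctx u ∼ ctx v
    ctx-cong = EqC.gfold (EqC.isEquivalence Step) ctx ctx-step

  ·-congˡ : ∀ {u v} w → u ∼ v → u · w ∼ v · w
  ·-congˡ {u} {v} w e = word≡ refl ◅◅ ctx-cong e ◅◅ word≡ refl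
    where open Context (alphabet w) [] (word w) (twice w)

  ·-congʳ : ∀ {u v} w → u ∼ v → w · u ∼ w · v
  ·-congʳ {u} {v} w e = flip u ◅◅ ctx-cong e ◅◅ ∼-sym (flip v)
    where
    open Context (alphabet w) (word w) [] (subst Twice (sym (++-identityʳ (word w))) (twice w))
    flip : ∀ u → w · u ∼ ctx u
    flip u = ≅⇒∼ (iso (⊎-comm _ _) (λ { (inj₁ A) → refl ; (inj₂ A) → refl })
      (begin
        map swap (map inj₁ (word w) ++ map inj₂ (word u))
          ≡⟨ map-++ swap (map inj₁ (word w)) _ ⟩
        map swap (map inj₁ (word w)) ++ map swap (map inj₂ (word u))
          ≡⟨ cong₂ _++_ (map-∘ (word w)) (map-∘ (word u)) ⟨
        map inj₂ (word w) ++ map inj₁ (word u)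
          ≡⟨ cong (map inj₂ (word w) ++_) (++-identityʳ _) ⟨
        map inj₂ (word w) ++ map inj₁ (word u) ++ [] ∎))
      where open ≡-Reasoning

  ·-assoc : ∀ u v w → (u · v) · w ∼ u · (v · w)
  ·-assoc u v w = ≅⇒∼ (iso (⊎-assoc 0ℓ _ _ _)
    (λ { (inj₁ (inj₁ A)) → refl ; (inj₁ (inj₂ A)) → refl ; (inj₂ A) → refl })
    (begin
      map f (map inj₁ (map inj₁ U ++ map inj₂ V) ++ map inj₂ W)
        ≡⟨ map-[] f (map inj₁ U ++ map inj₂ V) [] W ⟩
      map (f ∘ inj₁) (map inj₁ U ++ map inj₂ V) ++ map (f ∘ inj₂) W
        ≡⟨ cong (_++ map (f ∘ inj₂) W) (map-[] (f ∘ inj₁) U [] V) ⟩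
      (map inj₁ U ++ map (inj₂ ∘ inj₁) V) ++ map (inj₂ ∘ inj₂) W
        ≡⟨ ++-assoc (map inj₁ U) _ _ ⟩
      map inj₁ U ++ map (inj₂ ∘ inj₁) V ++ map (inj₂ ∘ inj₂) W
        ≡⟨ cong (map inj₁ U ++_) (map-[] inj₂ V [] W) ⟨
      map inj₁ U ++ map inj₂ (map inj₁ V ++ map inj₂ W) ∎))
    where
    open ≡-Reasoning
    U = word u ; V = word v ; W = word w
    f = Inverse.to (⊎-assoc 0ℓ (Letter (alphabet u)) (Letter (alphabet v)) (Letter (alphabet w)))

  ·-identityˡ : ∀ u → ∅ · u ∼ u
  ·-identityˡ u = ≅⇒∼ (iso ⊥⊎↔ (λ { (inj₁ ()) ; (inj₂ A) → refl })
    (trans (sym (map-∘ (word u))) (map-id (word u))))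

  ·-identityʳ : ∀ u → u · ∅ ∼ u
  ·-identityʳ u = ≅⇒∼ (iso ⊎⊥↔ (λ { (inj₁ A) → refl ; (inj₂ ()) })
    (trans (map-[] _ (word u) [] [])
      (trans (++-identityʳ _) (map-id (word u)))))

  -- w w⁻ is itself an even symmetric nanophrase, via the exchange of the two
  -- copies of the alphabet.
  ·-inverseʳ : ∀ u → u · u ⁻ ∼ ∅
  ·-inverseʳ u = proj₂ moved ◅◅ step (surgery ∇ ([] ∷ [] ∷ []) even sy)
    where
    W = word u
    v = map inj₁ W ++ map inj₂ (reverse W)

    ∇ : Nanophrase
    ∇ = nanophrase (alphabet u ⊕ alphabet u) (v ∷ [])
          (subst Twice (sym (++-identityʳ v)) (twice (u · u ⁻)))

    moved = relabel (u · u ⁻) {∅ᵃ ⊕ ∇.alphabet ∇} (↔-sym ⊥⊎↔) (λ _ → refl)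
              {map inj₂ v ++ []} (sym (++-identityʳ _))

    even : ∇.Even ∇
    even = divides (length W) (begin
      length v
        ≡⟨ length-++ (map inj₁ W) ⟩
      length (map inj₁ W) + length (map inj₂ (reverse W))
        ≡⟨ cong₂ _+_ (length-map inj₁ W)
                     (trans (length-map inj₂ (reverse W)) (length-reverse W)) ⟩
      length W + length W
        ≡⟨ cong (length W +_) (+-identityʳ (length W)) ⟨
      2 * length W
        ≡⟨ *-comm 2 (length W) ⟩
      length W * 2 ∎) ∷ []
      where open ≡-Reasoning

    ε∇≡0 : ∀ B → ∇.ε∇ ∇ B ≡ 0
    ε∇≡0 B with ∇.position ∇ B zero ≟ᶠ ∇.position ∇ B (suc zero)
    ... | yes _ = refl
    ... | no ¬p = contradiction (Fin1 _ _) ¬p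
      where
      Fin1 : (i j : Fin 1) → i ≡ j
      Fin1 zero zero = refl

    sy : ∇.Symmetric ∇
    sy = record
      { ι        = ⊎-comm _ _
      ; reverses = (begin
          map swap v
            ≡⟨ map-[] swap W [] (reverse W) ⟩
          map inj₂ W ++ map inj₁ (reverse W)
            ≡⟨ cong₂ _++_ (trans (cong (map inj₂) (sym (reverse-involutive W)))
                                 (reverse-map inj₂ (reverse W)))
                          (reverse-map inj₁ W) ⟩
          reverse (map inj₂ (reverse W)) ++ reverse (map inj₁ W)
            ≡⟨ reverse-++ (map inj₁ W) _ ⟨
          reverse v ∎) ∷ []
      ; label-ι  = λ B → trans (label-swap B)
                     (cong (fold (label (∇.alphabet ∇) B) τ) (sym (ε∇≡0 B)))
      }
      where
      open ≡-Reasoning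
      label-swap : ∀ B → label (∇.alphabet ∇) (swap B) ≡ label (∇.alphabet ∇) B
      label-swap (inj₁ A) = refl
      label-swap (inj₂ A) = refl

  ⁻-involutive : ∀ u → u ⁻ ⁻ ∼ u
  ⁻-involutive u = word≡ (reverse-involutive (word u))

  ·-inverseˡ : ∀ u → u ⁻ · u ∼ ∅
  ·-inverseˡ u = ·-congʳ (u ⁻) (∼-sym (⁻-involutive u)) ◅◅ ·-inverseʳ (u ⁻)

  ⁻-cong : ∀ {u v} → u ∼ v → u ⁻ ∼ v ⁻
  ⁻-cong {u} {v} e =
       ∼-sym (·-identityʳ (u ⁻))
    ◅◅ ·-congʳ (u ⁻) (∼-sym (·-inverseʳ v))
    ◅◅ ∼-sym (·-assoc (u ⁻) v (v ⁻))
    ◅◅ ·-congˡ (v ⁻) (·-congʳ (u ⁻) (∼-sym e) ◅◅ ·-inverseˡ u)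
    ◅◅ ·-identityˡ (v ⁻)

  𝒩c : Group (lsuc 0ℓ ⊔ a) (lsuc 0ℓ ⊔ a)
  𝒩c = record
    { Carrier = Nanoword
    ; _≈_     = _∼_
    ; _∙_     = _·_
    ; ε       = ∅
    ; _⁻¹     = _⁻
    ; isGroup = record
      { isMonoid = record
        { isSemigroup = record
          { isMagma = record
            { isEquivalence = EqC.isEquivalence Step
            ; ∙-cong        = λ {u} {u′} {v} {v′} p q → ·-congˡ v p ◅◅ ·-congʳ u′ q
            }
          ; assoc = ·-assoc
          }
        ; identity = ·-identityˡ , ·-identityʳ
        }
      ; inverse = ·-inverseˡ , ·-inverseʳ
      ; ⁻¹-cong = ⁻-cong
      }
    }

open Nanowords public using (𝒩c)

{-# OPTIONS --safe #-}
module Submission where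

-- Let Π be the group with generators α and relations c · τ c = 1.  Reading a
-- nanoword, with |A| for the first and τ|A| for the second occurrence of A, gives
-- an element γ of Π which is invariant under cobordism: a word of an even symmetric
-- factor reads as c₁⋯cₘ τcₘ⋯τc₁, hence as 1.  Since γ is
-- multiplicative and takes the word 1⋯n1⋯n labelled by c₁,…,cₙ to
-- c₁⋯cₙ τc₁⋯τcₙ, the theorem follows from actions of Π: of the infinite dihedral
-- group on ℤ (infinitude), of the symmetric group on 4 points (non-commutativity),
-- and of the lamplighter group.  For the latter γ always returns the lamplighter to
-- his starting point, because γ is trivial in the abelianisation of Π, so finitely
-- many nanowords can only reach a bounded set of lamps, whereas x^N y x^-N y
-- switches the lamp at N.

open import Defs
open import Level using (Level)
open import Algebra.Bundles using (Group)
open import Algebra.Definitions using (Involutive)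
open import Data.Product using (_×_; ∃-syntax)
open import Data.Sum using (_⊎_)
open import Relation.Binary.PropositionalEquality using (_≡_; _≢_)
open import Relation.Nullary using (¬_)

open import Data.Empty using (⊥-elim)
open import Data.Bool.Base using (Bool; true; false; not; if_then_else_)
open import Data.Bool.Properties using (not-involutive)
open import Data.Fin.Base using (Fin; zero; suc; inject₁)
open import Data.Fin.Permutation using (↔⇒≡)
open import Data.Fin.Properties as Finₚ using (+↔⊎; all?) renaming (_≟_ to _≟ᶠ_)
open import Data.Integer.Base using (ℤ; +_; -[1+_]; -_; pred)
  renaming (suc to sucℤ; _≤_ to _≤ᶻ_)
open import Data.Integer.Properties
  using (neg-involutive; +-injective; pred-suc; suc-pred; suc-mono; i≤j⇒pred[i]≤j;
         drop‿+≤+)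
  renaming (_≟_ to _≟ᶻ_; ≤-refl to ≤ᶻ-refl)
open import Data.List.Base
  using (List; []; _∷_; [_]; _∷ʳ_; _++_; map; concat; reverse; length; filter; lookup; allFin;
         initLast; _∷ʳ′_; replicate)
open import Data.List.Extrema.Nat using (max; xs≤max)
open import Data.List.Membership.Propositional using (_∈_; _∉_)
open import Data.List.Membership.Propositional.Properties
  using (∈-allFin; ∈-++⁺ˡ; ∈-++⁺ʳ; ∈-∃++; ∈-map⁺)
open import Data.List.Membership.Propositional.Properties.WithK using (unique⇒irrelevant)
open import Data.List.Properties
  using (filter-++; filter-accept; filter-reject; length-++; map-++; map-∘; map-id;
         map-tabulate; map-replicate; tabulate-lookup; ++-assoc; ++-identityʳ; unfold-reverse;
         reverse-++; ∷-injective; ∷ʳ-injective)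
open import Data.List.Relation.Binary.BagAndSetEquality using (↭⇒∼bag)
open import Data.List.Relation.Binary.Permutation.Propositional as Perm
  using (_↭_; ↭-sym; ↭-refl; prep)
open import Data.List.Relation.Binary.Permutation.Propositional.Properties
  using (↭-reverse; ++⁺ˡ; shift; ∈-resp-↭; ↭-length)
open import Data.List.Relation.Binary.Pointwise as PW using (Pointwise; []; _∷_)
open import Data.List.Relation.Unary.All as All using (All; []; _∷_)
open import Data.List.Relation.Unary.Any using (Any; here; there; index)
open import Data.List.Relation.Unary.Any.Properties
  using (lookup-index; ++↔; ∷↔; concat⁻; concat⁺; concat↔)
open import Data.List.Relation.Unary.Unique.Propositional using (Unique; []; _∷_)
open import Data.List.Relation.Unary.Unique.Propositional.Properties using (allFin⁺)
open import Data.Nat.Base using (ℕ; zero; suc; _+_; _*_; _≤_; _<_; z≤n; s≤s; s≤s⁻¹)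
open import Data.Nat.Divisibility using (_∣_; divides)
open import Data.Nat.GeneralisedArithmetic using (fold)
open import Data.Nat.Properties
  using (+-identityʳ; +-comm; +-suc; ≤-trans; ≤-reflexive; ≤-refl; m≤m+n; m≤n+m; suc-injective;
         n≤0⇒n≡0; ≤-antisym; +-monoˡ-≤; +-monoʳ-≤; +-cancelˡ-≤; +-cancelʳ-≤; n≤1+n; <-irrefl;
         +-assoc; *-cancelʳ-≡; +-cancelʳ-≡)
  renaming (_≟_ to _≟ⁿ_)
open import Data.Product.Base using (_,_; proj₁; proj₂)
open import Data.Sum.Base using (inj₁; inj₂; [_,_]′)
open import Data.Sum.Function.Propositional using (_⊎-cong_)
open import Data.Sum.Properties using (inj₁-injective; inj₂-injective; ≡-dec)
open import Data.Unit.Base using (⊤; tt)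
import Data.Unit.Properties as Unit
open import Data.Vec.Base using ([]; _∷_; toList)
open import Function.Base using (_∘_; id)
open import Function.Bundles using (_↔_; Inverse; Injection; Bijection; mk↔ₛ′)
open import Function.Definitions using (Injective)
open import Function.Properties.Inverse using (↔-sym; ↔-trans)
open import Relation.Binary.Bundles using (Setoid)
import Relation.Binary.Construct.Closure.Equivalence as EqC
open import Relation.Binary.Definitions using (DecidableEquality)
open import Relation.Binary.Structures using (IsEquivalence)
open import Relation.Binary.PropositionalEquality
  using (refl; sym; trans; cong; cong₂; subst; module ≡-Reasoning)
open import Relation.Nullary.Decidable
  using (yes; no; does; decidable-stable; toWitness; dec-true; dec-false)
open import Relation.Nullary.Negation using (contradiction)

≡-irr : {X : Set} {x y : X} (p q : x ≡ y) → p ≡ q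
≡-irr refl refl = refl

↔-injective : {X Y : Set} (f : X ↔ Y) → Injective _≡_ _≡_ (Inverse.to f)
↔-injective f {x} {y} e = trans (sym (Inverse.strictlyInverseʳ f x))
  (trans (cong (Inverse.from f) e) (Inverse.strictlyInverseʳ f y))

-- Counting occurrences of letters.

module Count {X : Set} (_≟_ : DecidableEquality X) where

  count : X → List X → ℕ
  count A w = length (filter (A ≟_) w)

  count-++ : ∀ A u v → count A (u ++ v) ≡ count A u + count A v
  count-++ A u v = trans (cong length (filter-++ (A ≟_) u v)) (length-++ (filter (A ≟_) u))

  count-here : ∀ A w → count A (A ∷ w) ≡ suc (count A w)
  count-here A w = cong length (filter-accept (A ≟_) refl)

  count-++-≤ : ∀ A u v → count A v ≤ count A (u ++ v)
  count-++-≤ A u v = ≤-trans (m≤n+m _ _) (≤-reflexive (sym (count-++ A u v)))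

  -- Lets bijections between sets of occurrences, the form in which `Twice` is stated, be exchanged
  -- for equations between numbers.
  count↔ : ∀ A w → (A ∈ w) ↔ Fin (count A w)
  count↔ A [] = mk↔ₛ′ (λ ()) (λ ()) (λ ()) (λ ())
  count↔ A (B ∷ w) with A ≟ B
  ... | yes refl = ↔-trans (↔-sym (∷↔ (A ≡_))) (↔-trans (refl↔ ⊎-cong count↔ A w) (↔-sym +↔⊎))
    where
    refl↔ : (A ≡ A) ↔ Fin 1
    refl↔ = mk↔ₛ′ (λ _ → zero) (λ _ → refl) (λ { zero → refl }) (λ _ → ≡-irr _ _)
  ... | no A≢B = ↔-trans (↔-sym (∷↔ (A ≡_))) (↔-trans (≢↔ ⊎-cong count↔ A w) (↔-sym +↔⊎))
    where
    ≢↔ : (A ≡ B) ↔ Fin 0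
    ≢↔ = mk↔ₛ′ (λ e → ⊥-elim (A≢B e)) (λ ()) (λ ()) (λ e → ⊥-elim (A≢B e))

  ∈⇒count≥1 : ∀ {A w} → A ∈ w → 1 ≤ count A w
  ∈⇒count≥1 {A} {w} i with count A w | Inverse.to (count↔ A w) i
  ... | suc _ | _ = s≤s z≤n

  ≢⇒count≥2 : ∀ {A w} (i j : A ∈ w) → i ≢ j → 2 ≤ count A w
  ≢⇒count≥2 {A} {w} i j i≢j with count A w | count↔ A w
  ... | zero | e with () ← Inverse.to e i
  ... | suc zero | e = ⊥-elim (i≢j (↔-injective e (Fin1 _ _)))
    where
    Fin1 : (i j : Fin 1) → i ≡ j
    Fin1 zero zero = refl
  ... | suc (suc _) | e = s≤s (s≤s z≤n)

  count≡0⇒∉ : ∀ {A w} → count A w ≡ 0 → A ∉ w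
  count≡0⇒∉ c i with () ← subst (1 ≤_) c (∈⇒count≥1 i)

  ∉⇒count≡0 : ∀ {A w} → A ∉ w → count A w ≡ 0
  ∉⇒count≡0 {A} {w} A∉w =
    ↔⇒≡ (↔-trans (↔-sym (count↔ A w))
          (mk↔ₛ′ (λ i → ⊥-elim (A∉w i)) (λ ()) (λ ()) (λ i → ⊥-elim (A∉w i))))

  count-↭ : ∀ A {u v} → u ↭ v → count A u ≡ count A v
  count-↭ A {u} {v} p = ↔⇒≡ (↔-trans (↔-sym (count↔ A u)) (↔-trans (↭⇒∼bag p) (count↔ A v)))

  twice⇒count : ∀ {w} → Twice w → ∀ A → count A w ≡ 2
  twice⇒count {w} p A = ↔⇒≡ (↔-trans (↔-sym (count↔ A w)) (p A))

module _ {X Y : Set} (_≟₁_ : DecidableEquality X) (_≟₂_ : DecidableEquality Y) where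
  open Count

  count-↔ : ∀ {A B u v} → (A ∈ u) ↔ (B ∈ v) → count _≟₁_ A u ≡ count _≟₂_ B v
  count-↔ {A} {B} {u} {v} e =
    ↔⇒≡ (↔-trans (↔-sym (count↔ _≟₁_ A u)) (↔-trans e (count↔ _≟₂_ B v)))

-- A letter is recovered from the position of one of its occurrences, and positions can be compared.
-- So the alphabet of a nanoword has decidable equality without any being assumed.
twice⇒≟ : {X : Set} {w : List X} → Twice w → DecidableEquality X
twice⇒≟ {w = w} p A B
  with index (Inverse.from (p A) zero) ≟ᶠ index (Inverse.from (p B) zero)
... | yes eq = yes (trans (lookup-index (Inverse.from (p A) zero))
                   (trans (cong (lookup w) eq) (sym (lookup-index (Inverse.from (p B) zero)))))
... | no neq = no λ { refl → neq refl }

-- The group Π and the reading γ of a nanoword.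

module Invariant {a : Level} {α : Set a} (τ : α → α) (τ-inv : Involutive _≡_ τ) where
  open Nanowords τ hiding (_[_]_; 𝒩c)
  open Alphabet using () renaming (∣_∣ to label)

  infix 4 _≃_

  -- Equality in Π.
  data _≃_ : List α → List α → Set a where
    ≃-refl  : ∀ {u} → u ≃ u
    ≃-sym   : ∀ {u v} → u ≃ v → v ≃ u
    ≃-trans : ∀ {u v w} → u ≃ v → v ≃ w → u ≃ w
    ≃-cons  : ∀ c {u v} → u ≃ v → c ∷ u ≃ c ∷ v
    cancel  : ∀ c u → c ∷ τ c ∷ u ≃ u

  cancel′ : ∀ c u → τ c ∷ c ∷ u ≃ u
  cancel′ c u = subst (λ d → τ c ∷ d ∷ u ≃ u) (τ-inv c) (cancel (τ c) u)

  ≃-reflexive : ∀ {u v} → u ≡ v → u ≃ v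
  ≃-reflexive refl = ≃-refl

  ≃-isEquivalence : IsEquivalence _≃_
  ≃-isEquivalence = record { refl = ≃-refl ; sym = ≃-sym ; trans = ≃-trans }

  ++-≃ˡ : ∀ x {u v} → u ≃ v → x ++ u ≃ x ++ v
  ++-≃ˡ []      e = e
  ++-≃ˡ (c ∷ x) e = ≃-cons c (++-≃ˡ x e)

  ++-≃ʳ : ∀ x {u v} → u ≃ v → u ++ x ≃ v ++ x
  ++-≃ʳ x ≃-refl        = ≃-refl
  ++-≃ʳ x (≃-sym e)     = ≃-sym (++-≃ʳ x e)
  ++-≃ʳ x (≃-trans e f) = ≃-trans (++-≃ʳ x e) (++-≃ʳ x f)
  ++-≃ʳ x (≃-cons c e)  = ≃-cons c (++-≃ʳ x e)
  ++-≃ʳ x (cancel c u)  = cancel c (u ++ x)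

  -- The generator read at an occurrence of a letter labelled c which is followed
  -- by n further occurrences of that letter.
  sgn : ℕ → α → α
  sgn zero    c = τ c
  sgn (suc _) c = c

  module Signs {X : Set} (_≟_ : DecidableEquality X) (lab : X → α) where
    open Count _≟_ public

    -- k counts the occurrences in the text to the right of the word.
    signs : (X → ℕ) → List X → List α
    signs k []      = []
    signs k (A ∷ w) = sgn (count A w + k A) (lab A) ∷ signs k w

    signs₀ : List X → List α
    signs₀ = signs (λ _ → 0)

    signs-cong-∈ : ∀ {k k′} w → (∀ {A} → A ∈ w → k A ≡ k′ A) → signs k w ≡ signs k′ w
    signs-cong-∈ []      e = refl
    signs-cong-∈ (A ∷ w) e =
      cong₂ _∷_ (cong (λ n → sgn (count A w + n) (lab A)) (e (here refl)))
                (signs-cong-∈ w (e ∘ there))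

    signs-cong : ∀ {k k′} → (∀ A → k A ≡ k′ A) → ∀ w → signs k w ≡ signs k′ w
    signs-cong e w = signs-cong-∈ w (λ {A} _ → e A)

    signs-++ : ∀ k u v → signs k (u ++ v) ≡ signs (λ A → count A v + k A) u ++ signs k v
    signs-++ k []      v = refl
    signs-++ k (A ∷ u) v = cong₂ _∷_
      (cong (λ n → sgn n (lab A))
        (trans (cong (_+ k A) (count-++ A u v)) (+-assoc (count A u) _ _)))
      (signs-++ k u v)

    signs₀-++ : ∀ u v → signs₀ (u ++ v) ≡ signs (λ A → count A v) u ++ signs₀ v
    signs₀-++ u v = trans (signs-++ _ u v)
      (cong (_++ signs₀ v) (signs-cong (λ A → +-identityʳ (count A v)) u))

    sgn-∈ : ∀ {A w} k c → A ∈ w → sgn (count A w + k) c ≡ c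
    sgn-∈ {A} {w} k c i with count A w | ∈⇒count≥1 i
    ... | suc _ | _ = refl

    sgn-∉ : ∀ {A w} c → A ∉ w → sgn (count A w + 0) c ≡ τ c
    sgn-∉ {A} {w} c i rewrite ∉⇒count≡0 i = refl

    signs-first : ∀ {k} w → (∀ A → 1 ≤ k A) → signs k w ≡ map lab w
    signs-first []      _ = refl
    signs-first {k} (A ∷ w) p = cong₂ _∷_ first (signs-first w p)
      where
      first : sgn (count A w + k A) (lab A) ≡ lab A
      first with count A w + k A | ≤-trans (p A) (m≤n+m (k A) (count A w))
      ... | suc _ | _ = refl

    signs-second : ∀ {w} → Unique w → signs₀ w ≡ map (τ ∘ lab) w
    signs-second []            = refl
    signs-second (A∉w ∷ w!) = cong₂ _∷_ (sgn-∉ _ (λ i → All.lookup A∉w i refl)) (signs-second w!)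

  module _ {X Y : Set} (_≟₁_ : DecidableEquality X) (_≟₂_ : DecidableEquality Y)
           {f : X → Y} (f-inj : Injective _≡_ _≡_ f) where
    open Count

    count-map : ∀ A w → count _≟₂_ (f A) (map f w) ≡ count _≟₁_ A w
    count-map A w = sym (count-↔ _≟₁_ _≟₂_ (Any≡ w λ _ →
      mk↔ₛ′ (cong f) f-inj (λ _ → ≡-irr _ _) (λ _ → ≡-irr _ _)))

    module _ {lab₁ : X → α} {lab₂ : Y → α} (lab : ∀ A → lab₂ (f A) ≡ lab₁ A) where
      open Signs

      signs-map : ∀ {k k′} → (∀ A → k′ (f A) ≡ k A) →
                  ∀ w → signs _≟₂_ lab₂ k′ (map f w) ≡ signs _≟₁_ lab₁ k w
      signs-map e []      = refl
      signs-map e (A ∷ w) =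
        cong₂ _∷_ (cong₂ sgn (cong₂ _+_ (count-map A w) (e A)) (lab A)) (signs-map e w)

  -- `γ` decides equality of letters through the `Twice` proof of its argument, and the two sides of
  -- the third move carry different proofs.
  signs₀-≟ : ∀ {X} (d d′ : DecidableEquality X) (lab : X → α) w →
             Signs.signs₀ d lab w ≡ Signs.signs₀ d′ lab w
  signs₀-≟ d d′ lab w =
    trans (cong (Signs.signs₀ d lab) (sym (map-id w)))
          (signs-map d′ d {f = id} (λ e → e) {lab₁ = lab} {lab₂ = lab} (λ _ → refl) (λ _ → refl) w)

  γ : Nanoword → List α
  γ u = Signs.signs₀ (twice⇒≟ (twice u)) (label (alphabet u)) (word u)

  γ-≅ : ∀ {u v} → u ≅ v → γ u ≡ γ v
  γ-≅ {u} {v} (iso f lab eq) = sym (trans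
    (cong (Signs.signs₀ (twice⇒≟ (twice v)) _) (sym eq))
    (signs-map _ _ (↔-injective f) lab (λ _ → refl) (word u)))

  -- No letter of `u` occurs in `v`, so no second occurrence in `u` becomes a first one.
  γ-· : ∀ u v → γ (u · v) ≡ γ u ++ γ v
  γ-· u v = trans (signs₀-++ (map inj₁ (word u)) (map inj₂ (word v))) (cong₂ _++_
    (signs-map _ _ inj₁-injective (λ _ → refl)
      (λ A → ∉⇒count≡0 (λ i → ⊥-elim (Inverse.from (∉₂ (word v)) i))) (word u))
    (signs-map _ _ inj₂-injective (λ _ → refl) (λ _ → refl) (word v)))
    where open Signs (twice⇒≟ (twice (u · v))) (label (alphabet (u · v)))

  -- Removal of a phrase whose words read as 1.

  module Removal {C B : Set} (dC : DecidableEquality C) (dB : DecidableEquality B)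
                 (d : DecidableEquality (C ⊎ B)) (labC : C → α) (labB : B → α) where
    private
      module C = Signs dC labC
      module B = Signs dB labB
    open Signs d [ labC , labB ]′

    -- Every vᵣ reads as the trivial element, in the context of vᵣ₊₁,…,vₖ.
    Vanishing : List (List B) → Set a
    Vanishing []       = Level.Lift _ ⊤
    Vanishing (v ∷ vs) = B.signs (λ A → B.count A (concat vs)) v ≃ [] × Vanishing vs

    count-inj₁ : ∀ A vs xs →
      count (inj₁ A) (interleave vs xs) ≡ C.count A (concat (toList xs))
    count-inj₁ A [] (x ∷ []) =
      trans (count-map dC d inj₁-injective A x) (cong (C.count A) (sym (++-identityʳ x)))
    count-inj₁ A (v ∷ vs) (x ∷ xs) = begin
      count (inj₁ A) (map inj₁ x ++ map inj₂ v ++ interleave vs xs)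
        ≡⟨ count-++ _ (map inj₁ x) _ ⟩
      count (inj₁ A) (map inj₁ x) + count (inj₁ A) (map inj₂ v ++ interleave vs xs)
        ≡⟨ cong₂ _+_ (count-map dC d inj₁-injective A x) (count-++ _ (map inj₂ v) _) ⟩
      C.count A x + (count (inj₁ A) (map inj₂ v) + count (inj₁ A) (interleave vs xs))
        ≡⟨ cong₂ _+_ refl (cong₂ _+_
             (∉⇒count≡0 (λ i → ⊥-elim (Inverse.from (∉₂ v) i))) (count-inj₁ A vs xs)) ⟩
      C.count A x + C.count A (concat (toList xs))
        ≡⟨ C.count-++ A x _ ⟨
      C.count A (x ++ concat (toList xs)) ∎
      where open ≡-Reasoning

    count-inj₂ : ∀ A vs xs → count (inj₂ A) (interleave vs xs) ≡ B.count A (concat vs)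
    count-inj₂ A [] (x ∷ []) = ∉⇒count≡0 (λ i → ⊥-elim (Inverse.from (∉₁ x) i))
    count-inj₂ A (v ∷ vs) (x ∷ xs) = begin
      count (inj₂ A) (map inj₁ x ++ map inj₂ v ++ interleave vs xs)
        ≡⟨ count-++ _ (map inj₁ x) _ ⟩
      count (inj₂ A) (map inj₁ x) + count (inj₂ A) (map inj₂ v ++ interleave vs xs)
        ≡⟨ cong₂ _+_ (∉⇒count≡0 (λ i → ⊥-elim (Inverse.from (∉₁ x) i)))
                     (count-++ _ (map inj₂ v) _) ⟩
      count (inj₂ A) (map inj₂ v) + count (inj₂ A) (interleave vs xs)
        ≡⟨ cong₂ _+_ (count-map dB d inj₂-injective A v) (count-inj₂ A vs xs) ⟩
      B.count A v + B.count A (concat vs)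
        ≡⟨ B.count-++ A v _ ⟨
      B.count A (v ++ concat vs) ∎
      where open ≡-Reasoning

    -- Deleting letters of `B` changes no count of a letter of `C`, so the gaps keep their
    -- generators, while each deleted word contributes a trivial factor. This serves the first two
    -- moves and surgery alike.
    signs-removal : ∀ vs xs → Vanishing vs →
                    signs₀ (interleave vs xs) ≃ C.signs₀ (concat (toList xs))
    signs-removal [] (x ∷ []) _ = ≃-reflexive
      (trans (signs-map dC d inj₁-injective (λ _ → refl) (λ _ → refl) x)
             (cong C.signs₀ (sym (++-identityʳ x))))
    signs-removal (v ∷ vs) (x ∷ xs) (van , vans) =
      ≃-trans (≃-reflexive (begin
        signs₀ (map inj₁ x ++ map inj₂ v ++ I)
          ≡⟨ signs₀-++ (map inj₁ x) _ ⟩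
        signs (λ A → count A (map inj₂ v ++ I)) (map inj₁ x) ++ signs₀ (map inj₂ v ++ I)
          ≡⟨ cong₂ _++_
               (signs-map dC d inj₁-injective (λ _ → refl)
                 (λ A → trans (count-++ _ (map inj₂ v) _)
                   (cong₂ _+_ (∉⇒count≡0 (λ i → ⊥-elim (Inverse.from (∉₂ v) i)))
                              (count-inj₁ A vs xs))) x)
               (trans (signs₀-++ (map inj₂ v) _) (cong (_++ signs₀ I)
                 (signs-map dB d inj₂-injective (λ _ → refl) (λ A → count-inj₂ A vs xs) v))) ⟩
        C.signs kx x ++ B.signs kv v ++ signs₀ I ∎))
      (≃-trans (++-≃ˡ (C.signs kx x)
        (≃-trans (++-≃ʳ (signs₀ I) van) (signs-removal vs xs vans)))
      (≃-reflexive (sym (C.signs₀-++ x _))))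
      where
      open ≡-Reasoning
      I  = interleave vs xs
      kx = λ A → C.count A (concat (toList xs))
      kv = λ A → B.count A (concat vs)

  -- Readings of words reversed by a symmetry.

  module _ {X : Set} (_≟_ : DecidableEquality X) (lab : X → α) where
    open Signs _≟_ lab

    -- The generators read from right to left, u being the text already read.
    signsʳ : (X → ℕ) → List X → List X → List α
    signsʳ k u []      = []
    signsʳ k u (A ∷ w) = sgn (count A u + k A) (lab A) ∷ signsʳ k (A ∷ u) w

    signsʳ-∷ʳ : ∀ k u w A →
      signsʳ k u (w ∷ʳ A) ≡ signsʳ k u w ∷ʳ sgn (count A (w ++ u) + k A) (lab A)
    signsʳ-∷ʳ k u []      A = refl
    signsʳ-∷ʳ k u (B ∷ w) A = cong (_ ∷_) (trans (signsʳ-∷ʳ k (B ∷ u) w A)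
      (cong (λ n → signsʳ k (B ∷ u) w ∷ʳ sgn (n + k A) (lab A)) (count-↭ A (shift B w u))))

    -- When `w` is read from its end, the text already read is exactly what stands to the right of
    -- the current letter, so each occurrence gets the same generator as before.
    reverse-signs : ∀ k w → reverse (signs k w) ≡ signsʳ k [] (reverse w)
    reverse-signs k []      = refl
    reverse-signs k (A ∷ w) = begin
      reverse (s ∷ signs k w)           ≡⟨ unfold-reverse s (signs k w) ⟩
      reverse (signs k w) ∷ʳ s          ≡⟨ cong₂ _∷ʳ_ (reverse-signs k w) eq ⟩
      signsʳ k [] (reverse w) ∷ʳ sgn (count A (reverse w ++ []) + k A) (lab A)
                                        ≡⟨ signsʳ-∷ʳ k [] (reverse w) A ⟨
      signsʳ k [] (reverse w ∷ʳ A)      ≡⟨ cong (signsʳ k []) (unfold-reverse A w) ⟨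
      signsʳ k [] (reverse (A ∷ w))     ∎
      where
      open ≡-Reasoning
      s  = sgn (count A w + k A) (lab A)
      eq : s ≡ sgn (count A (reverse w ++ []) + k A) (lab A)
      eq = cong (λ n → sgn (n + k A) (lab A)) (trans (count-↭ A (↭-sym (↭-reverse w)))
             (cong (count A) (sym (++-identityʳ (reverse w)))))

    module _ (ι : X ↔ X) where
      open Inverse ι using (to)

      -- The occurrence of A in v with m occurrences of A before it and n after it
      -- in v is mirrored by an occurrence of ι A with n before it and m after it.
      Mirrored : (X → ℕ) → List X → Set a
      Mirrored k v = ∀ A m n → suc (m + n) ≡ count A v →
                     sgn (m + k A) (lab (to A)) ≡ τ (sgn (n + k A) (lab A))

      -- Applying `ι` to `v` from left to right amounts to reading `v` from right to left. So the
      -- reversed reading can be compared with the reading itself place by place, and `Mirrored` is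
      -- that comparison.
      mirror : ∀ {k v} → (∀ A → k (to A) ≡ k A) → Mirrored k v → map to v ≡ reverse v →
               map τ (signs k v) ≡ reverse (signs k v)
      mirror {k} {v} kι mir rev =
        sym (trans (reverse-signs k v) (trans (cong (signsʳ k []) (sym rev))
          (go [] v (λ _ → refl))))
        where
        -- `l` is the part of `v` already passed, in reverse order; hence only the counts of
        -- `l ++ r` are compared with those of `v`.
        go : ∀ l r → (∀ A → count A (l ++ r) ≡ count A v) →
             signsʳ k (map to l) (map to r) ≡ map τ (signs k r)
        go l []      _ = refl
        go l (A ∷ r) c = cong₂ _∷_
          (trans (cong (λ n → sgn n (lab (to A)))
                       (cong₂ _+_ (count-map _≟_ _≟_ (↔-injective ι) A l) (kι A)))
                 (mir A (count A l) (count A r) (begin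
                   suc (count A l + count A r)    ≡⟨ +-suc (count A l) _ ⟨
                   count A l + suc (count A r)    ≡⟨ cong₂ _+_ refl (count-here A r) ⟨
                   count A l + count A (A ∷ r)    ≡⟨ count-++ A l _ ⟨
                   count A (l ++ A ∷ r)           ≡⟨ c A ⟩
                   count A v                      ∎)))
          (go (A ∷ l) r (λ B → trans (count-↭ B (↭-sym (shift A l r))) (c B)))
          where open ≡-Reasoning

      count-ι : ∀ {v} A → map to v ≡ reverse v → count (to A) v ≡ count A v
      count-ι {v} A rev = begin
        count (to A) v            ≡⟨ count-↭ (to A) (↭-reverse v) ⟨
        count (to A) (reverse v)  ≡⟨ cong (count (to A)) rev ⟨
        count (to A) (map to v)   ≡⟨ count-map _≟_ _≟_ (↔-injective ι) A v ⟩
        count A v                 ∎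
        where open ≡-Reasoning

      count-concat-ι : ∀ {vs} A → All (λ v → map to v ≡ reverse v) vs →
                       count (to A) (concat vs) ≡ count A (concat vs)
      count-concat-ι A []                       = refl
      count-concat-ι A (_∷_ {v} {vs} rev revs) = begin
        count (to A) (v ++ concat vs)                ≡⟨ count-++ (to A) v _ ⟩
        count (to A) v + count (to A) (concat vs)
          ≡⟨ cong₂ _+_ (count-ι A rev) (count-concat-ι A revs) ⟩
        count A v + count A (concat vs)              ≡⟨ count-++ A v _ ⟨
        count A (v ++ concat vs)                     ∎
        where open ≡-Reasoning

  -- The last generator is `τ` of the first, so the two cancel once the part between them has. Even
  -- length excludes a middle generator, which would be a fixed point of `τ` and need not be
  -- trivial.
  antipalindrome≃[] : ∀ n g → length g ≡ n * 2 → map τ g ≡ reverse g → g ≃ []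
  antipalindrome≃[] zero    []      _   _   = ≃-refl
  antipalindrome≃[] (suc n) (c ∷ g) len pal with initLast g
  antipalindrome≃[] (suc n) (c ∷ .[]) () pal | []
  antipalindrome≃[] (suc n) (c ∷ .(m ∷ʳ e)) len pal | m ∷ʳ′ e =
    subst (λ e → c ∷ m ∷ʳ e ≃ []) τc≡e
      (≃-trans (≃-cons c (++-≃ʳ [ τ c ] (antipalindrome≃[] n m len′ pal′))) (cancel c []))
    where
    open ≡-Reasoning
    len′ : length m ≡ n * 2
    len′ = suc-injective (suc-injective (trans (cong suc (trans (+-comm 1 _)
             (sym (length-++ m)))) len))
    split : τ c ∷ (map τ m ∷ʳ τ e) ≡ e ∷ (reverse m ∷ʳ c)
    split = begin
      τ c ∷ (map τ m ∷ʳ τ e)  ≡⟨ cong (τ c ∷_) (map-++ τ m [ e ]) ⟨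
      map τ (c ∷ m ∷ʳ e)      ≡⟨ pal ⟩
      reverse (c ∷ m ∷ʳ e)    ≡⟨ unfold-reverse c (m ∷ʳ e) ⟩
      reverse (m ∷ʳ e) ∷ʳ c   ≡⟨ cong (_∷ʳ c) (reverse-++ m [ e ]) ⟩
      e ∷ (reverse m ∷ʳ c)    ∎
    τc≡e = proj₁ (∷-injective split)
    pal′ : map τ m ≡ reverse m
    pal′ = proj₁ (∷ʳ-injective _ _ (proj₂ (∷-injective split)))

  -- Locating the two occurrences of a letter in a phrase.

  module _ {X : Set} (_≟_ : DecidableEquality X) where
    open Count _≟_

    count-concat-≤ : ∀ A {v vs} → v ∈ vs → count A v ≤ count A (concat vs)
    count-concat-≤ A {vs = w ∷ vs} (here refl) =
      ≤-trans (m≤m+n _ _) (≤-reflexive (sym (count-++ A w _)))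
    count-concat-≤ A {vs = w ∷ vs} (there i)   =
      ≤-trans (count-concat-≤ A i) (count-++-≤ A w _)

    -- Two distinct occurrences exhaust the bound 2, so a word containing `A` holds both of them or
    -- just one. The bound is an inequality in order to pass to the tail of the phrase.
    two-occurrences : ∀ {A vs} (o o′ : Any (A ∈_) vs) → o ≢ o′ → count A (concat vs) ≤ 2 →
      ∀ {v} → v ∈ vs → 1 ≤ count A v →
      (index o ≡ index o′ → count A v ≡ 2) × (index o ≢ index o′ → count A v ≡ 1)
    two-occurrences {A} {w ∷ vs} o o′ o≢o′ ≤2 {v} v∈ v≥1 = go o o′ o≢o′ v∈
      where
      total : count A w + count A (concat vs) ≤ 2
      total = ≤-trans (≤-reflexive (sym (count-++ A w _))) ≤2

      rest≤ : ∀ {n} → suc n ≤ count A w → suc n + count A (concat vs) ≤ 2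
      rest≤ p = ≤-trans (+-monoˡ-≤ _ p) total

      word≤ : ∀ {n} → suc n ≤ count A (concat vs) → count A w + suc n ≤ 2
      word≤ p = ≤-trans (+-monoʳ-≤ _ p) total

      mixed : A ∈ w → Any (A ∈_) vs → v ∈ w ∷ vs → count A v ≡ 1
      mixed i o v∈ = ≤-antisym (v≤1 v∈) v≥1
        where
        v≤1 : v ∈ w ∷ vs → count A v ≤ 1
        v≤1 (here refl) = +-cancelʳ-≤ 1 _ 1 (word≤ (∈⇒count≥1 (concat⁺ o)))
        v≤1 (there j)   = ≤-trans (count-concat-≤ A j) (s≤s⁻¹ (rest≤ (∈⇒count≥1 i)))

      go : (o o′ : Any (A ∈_) (w ∷ vs)) → o ≢ o′ → v ∈ w ∷ vs →
           (index o ≡ index o′ → count A v ≡ 2) × (index o ≢ index o′ → count A v ≡ 1)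
      go (here i) (here j) i≢j (here refl) =
        (λ _ → ≤-antisym (≤-trans (m≤m+n _ _) total) (≢⇒count≥2 i j (i≢j ∘ cong here))) ,
        (λ ne → ⊥-elim (ne refl))
      go (here i) (here j) i≢j (there v∈) =
        contradiction (≤-trans v≥1 (≤-trans (count-concat-≤ A v∈)
          (s≤s⁻¹ (s≤s⁻¹ (rest≤ (≢⇒count≥2 i j (i≢j ∘ cong here))))))) λ ()
      go (here i)  (there o) _ v∈ = (λ ()) , λ _ → mixed i o v∈
      go (there o) (here i)  _ v∈ = (λ ()) , λ _ → mixed i o v∈
      go (there o) (there o′) o≢o′ (here refl) =
        contradiction (≤-trans (+-monoˡ-≤ 2 v≥1)
          (word≤ (≢⇒count≥2 (concat⁺ o) (concat⁺ o′)
            (o≢o′ ∘ cong there ∘ ↔-injective concat↔)))) λ { (s≤s (s≤s ())) }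
      go (there o) (there o′) o≢o′ (there v∈)
        with two-occurrences o o′ (o≢o′ ∘ cong there) (≤-trans (m≤n+m _ _) total) v∈ v≥1
      ... | p , q = (λ e → p (Finₚ.suc-injective e)) , (λ ne → q (ne ∘ cong suc))

  module _ (∇ : Nanophrase) where
    open Nanophrase ∇ using (ε∇; position; words) renaming (twice to twice∇; alphabet to ℬ)
    private
      _≟_ = twice⇒≟ twice∇
      module B = Signs _≟_ (label ℬ)

    ε∇-same : ∀ B → position B zero ≡ position B (suc zero) → ε∇ B ≡ 0
    ε∇-same B e with position B zero ≟ᶠ position B (suc zero)
    ... | yes _ = refl
    ... | no ne = ⊥-elim (ne e)

    ε∇-different : ∀ B → position B zero ≢ position B (suc zero) → ε∇ B ≡ 1
    ε∇-different B ne with position B zero ≟ᶠ position B (suc zero)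
    ... | yes e = ⊥-elim (ne e)
    ... | no _  = refl

    -- Translates `ε∇`, defined by positions, into the counts on which readings depend.
    count⇒ε∇ : ∀ {v} → v ∈ words → ∀ B →
               (B.count B v ≡ 2 → ε∇ B ≡ 0) × (B.count B v ≡ 1 → ε∇ B ≡ 1)
    count⇒ε∇ {v} v∈ B = twice-case , once-case
      where
      occ : ∀ i → Any (B ∈_) words
      occ i = concat⁻ words (Inverse.from (twice∇ B) i)
      occ≢ : occ zero ≢ occ (suc zero)
      occ≢ e with () ← ↔-injective (↔-sym (twice∇ B)) (↔-injective (↔-sym concat↔) e)
      two = two-occurrences _≟_ (occ zero) (occ (suc zero)) occ≢
              (≤-reflexive (B.twice⇒count twice∇ B)) v∈
      twice-case : B.count B v ≡ 2 → ε∇ B ≡ 0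
      twice-case c = ε∇-same B (decidable-stable (_ ≟ᶠ _) λ ne →
        contradiction (trans (sym c)
          (proj₂ (two (≤-trans (s≤s z≤n) (≤-reflexive (sym c)))) ne)) λ ())
      once-case : B.count B v ≡ 1 → ε∇ B ≡ 1
      once-case c = ε∇-different B λ e →
        contradiction (trans (sym c) (proj₁ (two (≤-reflexive (sym c))) e)) λ ()

    module _ {C : Set} (dC : DecidableEquality C) (d : DecidableEquality (C ⊎ Letter ℬ))
             (labC : C → α) (even : ∇.Even ∇) (sy : ∇.Symmetric ∇) where
      open Removal dC _≟_ d labC (label ℬ)
      open Nanophrase.Symmetric sy
      open Inverse ι using (to)

      -- If both occurrences of `B` lie in `v`, then `ι` keeps the label but exchanges first and
      -- second occurrences. If only one does, `ι` applies `τ` to the label and first stays first,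
      -- second stays second. Either way the mirrored generator is the inverse one, and
      -- `antipalindrome≃[]` applies.
      symmetric⇒vanishing : Vanishing words
      symmetric⇒vanishing =
        go words id even reverses λ B → ≤-reflexive (B.twice⇒count twice∇ B)
        where
        -- In a final segment of the phrase a letter may have lost occurrences, hence only the bound
        -- 2; `ε∇` still refers to the whole phrase, hence the inclusion into `words`.
        go : ∀ vs → (∀ {v} → v ∈ vs → v ∈ words) → All (λ v → 2 ∣ length v) vs →
             All (λ v → map to v ≡ reverse v) vs → (∀ B → B.count B (concat vs) ≤ 2) → Vanishing vs
        go [] _ _ _ _ = _
        go (v ∷ vs) incl (divides n len ∷ evs) (rev ∷ revs) ≤2 =
          antipalindrome≃[] n _ (trans (length-signs v) len)
            (mirror _≟_ (label ℬ) ι (λ A → count-concat-ι _≟_ (label ℬ) ι A revs) mirrored rev) ,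
          go vs (incl ∘ there) evs revs (λ B → ≤-trans (B.count-++-≤ B v _) (≤2 B))
          where
          k = λ A → B.count A (concat vs)
          length-signs : ∀ w → length (B.signs k w) ≡ length w
          length-signs []      = refl
          length-signs (A ∷ w) = cong suc (length-signs w)

          total : ∀ B → B.count B v + k B ≤ 2
          total B = ≤-trans (≤-reflexive (sym (B.count-++ B v _))) (≤2 B)

          label-to : ∀ B → B.count B v ≡ 1 → label ℬ (to B) ≡ τ (label ℬ B)
          label-to B c = trans (label-ι B)
            (cong (fold (label ℬ B) τ) (proj₂ (count⇒ε∇ (incl (here refl)) B) c))

          label-to₂ : ∀ B → B.count B v ≡ 2 → label ℬ (to B) ≡ label ℬ B
          label-to₂ B c = trans (label-ι B)
            (cong (fold (label ℬ B) τ) (proj₁ (count⇒ε∇ (incl (here refl)) B) c))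

          k≡0 : ∀ B → B.count B v ≡ 2 → k B ≡ 0
          k≡0 B c = n≤0⇒n≡0 (+-cancelˡ-≤ 2 _ 0 (subst (λ n → n + k B ≤ 2) c (total B)))

          count≱3 : ∀ B {n} → 3 + n ≢ B.count B v
          count≱3 B c =
            contradiction (subst (_≤ 2) (sym c) (≤-trans (m≤m+n _ _) (total B)))
              λ { (s≤s (s≤s ())) }

          mirrored : Mirrored _≟_ (label ℬ) ι k v
          mirrored B zero zero c = trans (cong (sgn (k B)) (label-to B (sym c))) (sgn-τ (k B) _)
            where
            sgn-τ : ∀ n b → sgn n (τ b) ≡ τ (sgn n b)
            sgn-τ zero    b = refl
            sgn-τ (suc _) b = refl
          mirrored B zero (suc zero) c =
            cong₂ sgn (k≡0 B (sym c)) (label-to₂ B (sym c))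
          mirrored B (suc zero) zero c =
            trans (label-to₂ B (sym c))
              (sym (trans (cong (λ n → τ (sgn n (label ℬ B))) (k≡0 B (sym c))) (τ-inv _)))
          mirrored B zero (suc (suc n)) c = ⊥-elim (count≱3 B c)
          mirrored B (suc zero) (suc n) c = ⊥-elim (count≱3 B c)
          mirrored B (suc (suc m)) n    c = ⊥-elim (count≱3 B c)

  -- The third move.

  module _ {𝒜 : Alphabet} (A B C : Letter 𝒜) (x y z t : List (Letter 𝒜))
           (A≢B : A ≢ B) (B≢C : B ≢ C) (A≢C : A ≢ C)
           (ab : label 𝒜 A ≡ label 𝒜 B) (bc : label 𝒜 B ≡ label 𝒜 C) where

    private
      T₀ T₁ T₂ T₀′ T₁′ T₂′ : List (Letter 𝒜)
      T₂  = z ++ B ∷ C ∷ t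
      T₂′ = z ++ C ∷ B ∷ t
      T₁  = y ++ A ∷ C ∷ T₂
      T₁′ = y ++ C ∷ A ∷ T₂′
      T₀  = A ∷ B ∷ T₁
      T₀′ = B ∷ A ∷ T₁′

    -- With `c` the common label, and apart from the unchanged reading of `x`, the sides read as
    -- `c c Y (τ c) c Z (τ c) (τ c)` and `c c Y c (τ c) Z (τ c) (τ c)`, followed by the same reading
    -- of `t`. They differ only in the pair after `Y`, which cancels in both.
    γ-move₃ : ∀ {p q} → γ (nanoword 𝒜 (x ++ T₀) p) ≃ γ (nanoword 𝒜 (x ++ T₀′) q)
    γ-move₃ {p} {q} =
      ≃-trans (≃-reflexive (signs₀-++ x T₀))
      (≃-trans (≃-reflexive (cong (_++ signs₀ T₀) (signs-cong (λ D → count-↭ D perm₀) x)))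
      (≃-trans (++-≃ˡ (signs (λ D → count D T₀′) x)
        (≃-trans (≃-reflexive readT₀)
        (≃-trans (≃-cons _ (≃-cons _ (++-≃ˡ Y (≃-trans (cancel′ _ _) (≃-sym (cancel _ _))))))
                 (≃-reflexive (sym readT₀′)))))
      (≃-reflexive (sym (trans (signs₀-≟ _ _ _ (x ++ T₀′)) (signs₀-++ x T₀′))))))
      where
      open Signs (twice⇒≟ p) (label 𝒜)

      perm₂ : T₂ ↭ T₂′
      perm₂ = ++⁺ˡ z (Perm.swap B C ↭-refl)
      perm₁ : T₁ ↭ T₁′
      perm₁ = ++⁺ˡ y (Perm.swap A C perm₂)
      perm₀ : T₀ ↭ T₀′
      perm₀ = Perm.swap A B perm₁

      -- The two displayed occurrences of `D` are all there are.
      second : ∀ D u v w → x ++ T₀ ≡ u ++ D ∷ v ++ D ∷ w → D ∉ w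
      second D u v w e = count≡0⇒∉ (n≤0⇒n≡0 (s≤s⁻¹ (s≤s⁻¹ (
        ≤-trans (≤-reflexive (cong suc (sym (count-here D w))))
        (≤-trans (s≤s (count-++-≤ D v _))
        (≤-trans (≤-reflexive (sym (count-here D _)))
        (≤-trans (count-++-≤ D u _)
        (≤-reflexive (trans (cong (count D) (sym e)) (twice⇒count p D))))))))))

      A∉ : A ∉ C ∷ T₂
      A∉ = second A x (B ∷ y) _ refl
      B∉ : B ∉ C ∷ t
      B∉ = second B (x ∷ʳ A) (y ++ A ∷ C ∷ z) _
             (trans (sym (++-assoc x [ A ] _))
               (cong (λ w → (x ∷ʳ A) ++ B ∷ w) (sym (++-assoc y _ _))))
      C∉ : C ∉ t
      C∉ = second C (x ++ A ∷ B ∷ y ∷ʳ A) (z ∷ʳ B) _ (sym (trans (++-assoc x _ _)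
             (cong (λ w → x ++ A ∷ B ∷ w) (trans (++-assoc y _ _)
               (cong (λ w → y ++ A ∷ C ∷ w) (++-assoc z _ _))))))

      c = label 𝒜 A
      Y = signs (λ D → count D (C ∷ A ∷ T₂′)) y
      Z = signs (λ D → count D (C ∷ B ∷ t)) z
      tail = Z ++ τ c ∷ τ c ∷ signs₀ t

      lB : label 𝒜 B ≡ c
      lB = sym ab
      lC : label 𝒜 C ≡ c
      lC = sym (trans ab bc)

      readT₂ : signs₀ T₂ ≡ tail
      readT₂ = trans (signs₀-++ z _) (cong₂ _++_
        (signs-cong (λ D → count-↭ D (Perm.swap B C ↭-refl)) z)
        (cong₂ _∷_ (trans (sgn-∉ _ B∉) (cong τ lB))
          (cong₂ _∷_ (trans (sgn-∉ _ C∉) (cong τ lC)) refl)))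

      readT₂′ : signs₀ T₂′ ≡ tail
      readT₂′ = trans (signs₀-++ z _) (cong (Z ++_)
        (cong₂ _∷_ (trans (sgn-∉ {w = B ∷ t} _ λ { (here e) → B≢C (sym e) ; (there i) → C∉ i })
                      (cong τ lC))
          (cong₂ _∷_ (trans (sgn-∉ _ (B∉ ∘ there)) (cong τ lB)) refl)))

      readT₀ : signs₀ T₀ ≡ c ∷ c ∷ Y ++ τ c ∷ c ∷ tail
      readT₀ = cong₂ _∷_ (sgn-∈ _ _ (there (∈-++⁺ʳ y (here refl))))
        (cong₂ _∷_ (trans (sgn-∈ _ _ (∈-++⁺ʳ y (there (there (∈-++⁺ʳ z (here refl)))))) lB)
          (trans (signs₀-++ y _) (cong₂ _++_
            (signs-cong (λ D → count-↭ D (Perm.swap A C perm₂)) y)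
            (cong₂ _∷_ (sgn-∉ _ A∉) (cong₂ _∷_
              (trans (sgn-∈ _ _ (∈-++⁺ʳ z (there (here refl)))) lC) readT₂)))))

      readT₀′ : signs₀ T₀′ ≡ c ∷ c ∷ Y ++ c ∷ τ c ∷ tail
      readT₀′ = cong₂ _∷_
        (trans (sgn-∈ _ _ (there (∈-++⁺ʳ y (there (there (∈-++⁺ʳ z (there (here refl)))))))) lB)
        (cong₂ _∷_ (sgn-∈ _ _ (∈-++⁺ʳ y (there (here refl))))
          (trans (signs₀-++ y _) (cong (Y ++_)
            (cong₂ _∷_ (trans (sgn-∈ _ _ (there (∈-++⁺ʳ z (here refl)))) lC) (cong₂ _∷_
              (sgn-∉ _ (A∉ ∘ there ∘ ∈-resp-↭ (↭-sym perm₂))) readT₂′)))))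

  -- The first two moves remove the phrases `AA` and `AB|BA`. Here `AA` reads as `a (τ a)`, and the
  -- words of the other as `a b` and `(τ b) (τ a)`, all trivial when `b` is `τ a`.
  γ-step : ∀ {u v} → Step u v → γ u ≃ γ v
  γ-step (isomorphism e) = ≃-reflexive (γ-≅ e)
  γ-step (move₁ {𝒞} a x y {p} {q}) =
    ≃-trans (signs-removal ((tt ∷ tt ∷ []) ∷ []) (x ∷ y ∷ []) (cancel a [] , _))
            (≃-reflexive (cong (λ y → Signs.signs₀ (twice⇒≟ q) (label 𝒞) (x ++ y))
                               (++-identityʳ y)))
    where open Removal (twice⇒≟ q) Unit._≟_ (twice⇒≟ p) (label 𝒞) (label ⟨ a ⟩ᵃ)
  γ-step (move₂ {𝒞} a b x y z b≡τa {p} {q}) =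
    ≃-trans (signs-removal ((inj₁ tt ∷ inj₂ tt ∷ []) ∷ (inj₂ tt ∷ inj₁ tt ∷ []) ∷ [])
                           (x ∷ y ∷ z ∷ [])
              (subst (λ b → a ∷ b ∷ [] ≃ []) (sym b≡τa) (cancel a []) ,
               subst (λ b → τ b ∷ τ a ∷ [] ≃ []) (sym b≡τa) (cancel′ (τ a) []) , _))
            (≃-reflexive (cong (λ z → Signs.signs₀ (twice⇒≟ q) (label 𝒞) (x ++ y ++ z))
                               (++-identityʳ z)))
    where
    open Removal (twice⇒≟ q) (≡-dec Unit._≟_ Unit._≟_) (twice⇒≟ p)
                 (label 𝒞) (label (⟨ a ⟩ᵃ ⊕ ⟨ b ⟩ᵃ))
  γ-step (move₃ A B C x y z t A≢B B≢C A≢C ab bc) = γ-move₃ A B C x y z t A≢B B≢C A≢C ab bc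
  γ-step (surgery {𝒞} ∇ xs even sy {p} {q}) =
    Removal.signs-removal _ _ _ _ _ (∇.words ∇) xs
      (symmetric⇒vanishing ∇ (twice⇒≟ q) (twice⇒≟ p) (label 𝒞) even sy)

  γ-∼ : ∀ {u v} → u ∼ v → γ u ≃ γ v
  γ-∼ = EqC.gfold ≃-isEquivalence γ γ-step

  -- Triviality of γ in the abelianisation of Π.

  pairs : List α → List α
  pairs []       = []
  pairs (c ∷ cs) = c ∷ τ c ∷ pairs cs

  pairs≃[] : ∀ cs → pairs cs ≃ []
  pairs≃[] []       = ≃-refl
  pairs≃[] (c ∷ cs) = ≃-trans (cancel c _) (pairs≃[] cs)

  module _ {X : Set} (_≟_ : DecidableEquality X) (lab : X → α) where
    open Signs _≟_ lab

    -- The two occurrences of the leading letter contribute its label and `τ` of it, and deleting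
    -- them leaves the other generators unchanged. The recursion is on the length bound `n`, as the
    -- shortened word is not a subterm.
    signs₀-↭-pairs : ∀ n w → length w ≤ n → (∀ {A} → A ∈ w → count A w ≡ 2) →
                     ∃[ cs ] signs₀ w ↭ pairs cs
    signs₀-↭-pairs _       []      _       _ = [] , ↭-refl
    signs₀-↭-pairs (suc n) (A ∷ w) (s≤s len) two = split (∈-∃++ A∈w)
      where
      once : count A w ≡ 1
      once = suc-injective (trans (sym (count-here A w)) (two (here refl)))

      A∈w : A ∈ w
      A∈w = Inverse.from (count↔ A w) (subst Fin (sym once) zero)

      split : (∃[ u ] ∃[ v ] w ≡ u ++ [ A ] ++ v) → ∃[ cs ] signs₀ (A ∷ w) ↭ pairs cs
      split (u , v , refl) = lab A ∷ proj₁ rest , (begin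
        signs₀ (A ∷ u ++ A ∷ v)
          ≡⟨ cong₂ _∷_ (sgn-∈ 0 (lab A) (∈-++⁺ʳ u (here refl))) (signs₀-++ u (A ∷ v)) ⟩
        lab A ∷ signs (λ D → count D (A ∷ v)) u ++ signs₀ (A ∷ v)
          ≡⟨ cong (lab A ∷_) (cong₂ _++_
               (signs-cong-∈ u (λ i → count-skip v (λ { refl → A∉uv (∈-++⁺ˡ i) })))
               (cong (_∷ signs₀ v) (sgn-∉ (lab A) (A∉uv ∘ ∈-++⁺ʳ u)))) ⟩
        lab A ∷ signs (λ D → count D v) u ++ τ (lab A) ∷ signs₀ v
          ↭⟨ prep _ (shift _ (signs (λ D → count D v) u) _) ⟩
        lab A ∷ τ (lab A) ∷ signs (λ D → count D v) u ++ signs₀ v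
          ≡⟨ cong (λ s → lab A ∷ τ (lab A) ∷ s) (signs₀-++ u v) ⟨
        lab A ∷ τ (lab A) ∷ signs₀ (u ++ v)
          ↭⟨ prep _ (prep _ (proj₂ rest)) ⟩
        pairs (lab A ∷ proj₁ rest) ∎)
        where
        open Perm.PermutationReasoning

        count-skip : ∀ {D} v → D ≢ A → count D (A ∷ v) ≡ count D v
        count-skip v D≢A = cong length (filter-reject (_ ≟_) D≢A)

        A∉uv : A ∉ u ++ v
        A∉uv = count≡0⇒∉ (suc-injective (trans (sym (count-here A (u ++ v)))
                 (trans (count-↭ A (↭-sym (shift A u v))) once)))

        two′ : ∀ {D} → D ∈ u ++ v → count D (u ++ v) ≡ 2
        two′ {D} i =
          trans (sym (count-skip (u ++ v) D≢A))
            (trans (count-↭ D (↭-sym (shift A u v)))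
            (trans (sym (count-skip (u ++ A ∷ v) D≢A))
              (two (there (∈-resp-↭ (↭-sym (shift A u v)) (there i))))))
          where
          D≢A : D ≢ A
          D≢A refl = A∉uv i

        rest = signs₀-↭-pairs n (u ++ v)
          (≤-trans (n≤1+n _) (≤-trans (≤-reflexive (sym (↭-length (shift A u v)))) len)) two′

  γ-↭-pairs : ∀ u → ∃[ cs ] γ u ↭ pairs cs
  γ-↭-pairs u = signs₀-↭-pairs d (label (alphabet u)) _ (word u) ≤-refl
                  (λ {A} _ → Count.twice⇒count d (twice u) A)
    where d = twice⇒≟ (twice u)

  -- Nanowords with prescribed readings.

  double : List α → Nanoword
  double cs = nanoword (record { Letter = Fin n ; ∣_∣ = lookup cs }) (allFin n ++ allFin n)
    λ A → ↔-trans (↔-sym ++↔) (↔-trans (once A ⊎-cong once A) (↔-sym +↔⊎))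
    where
    n = length cs
    once : ∀ A → (A ∈ allFin n) ↔ Fin 1
    once A = mk↔ₛ′ (λ _ → zero) (λ _ → ∈-allFin A) (λ { zero → refl })
                   (λ i → unique⇒irrelevant (allFin⁺ n) _ i)

  γ-double : ∀ cs → γ (double cs) ≡ cs ++ map τ cs
  γ-double cs = begin
    signs₀ (F ++ F)
      ≡⟨ signs₀-++ F F ⟩
    signs (λ A → count A F) F ++ signs₀ F
      ≡⟨ cong₂ _++_ (signs-first F (λ A → ∈⇒count≥1 (∈-allFin A))) (signs-second (allFin⁺ _)) ⟩
    map (lookup cs) F ++ map (τ ∘ lookup cs) F
      ≡⟨ cong (map (lookup cs) F ++_) (map-∘ F) ⟩
    map (lookup cs) F ++ map τ (map (lookup cs) F)
      ≡⟨ cong (λ w → w ++ map τ w) (trans (map-tabulate id (lookup cs)) (tabulate-lookup cs)) ⟩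
    cs ++ map τ cs ∎
    where
    open ≡-Reasoning
    open Signs (twice⇒≟ (twice (double cs))) (lookup cs)
    F = allFin (length cs)

  -- Actions of Π on sets of states.

  -- A partial map from α to K, given by its fibres and commuting with the
  -- involutions; it need not be decidable whether it is defined at a given point.
  record Labelling : Set (Level.suc a) where
    field
      K      : Set
      P      : K → α → Set a
      τᴷ     : K → K
      unique : ∀ {j k c} → P j c → P k c → j ≡ k
      P-τ    : ∀ {k c} → P k c → P (τᴷ k) (τ c)

  -- The labels of type k act by σ k and all others act trivially.  Lacking a
  -- decision of the type of a label, the action is a relation: functional, and
  -- total up to double negation.
  module Action (L : Labelling) {S : Set} (σ : Labelling.K L → S → S)
                (σ-inv : ∀ k s → σ (Labelling.τᴷ L k) (σ k s) ≡ s) where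
    open Labelling L

    data Acts (c : α) (s : S) : S → Set a where
      move : ∀ k → P k c → Acts c s (σ k s)
      stay : (∀ k → ¬ P k c) → Acts c s s

    data Run : List α → S → S → Set a where
      []  : ∀ {s} → Run [] s s
      _∷_ : ∀ {c u s t r} → Acts c s t → Run u t r → Run (c ∷ u) s r

    acts-functional : ∀ {c s t t′} → Acts c s t → Acts c s t′ → t ≡ t′
    acts-functional (move j p) (move k q) = cong (λ k → σ k _) (unique p q)
    acts-functional (move j p) (stay q)   = ⊥-elim (q j p)
    acts-functional (stay p)   (move k q) = ⊥-elim (p k q)
    acts-functional (stay p)   (stay q)   = refl

    -- If there were no result, no type could fit `c`, and then `stay` would give one.
    acts-total : ∀ c s → ¬ ¬ (∃[ t ] Acts c s t)
    acts-total c s none = none (s , stay λ k p → none (σ k s , move k p))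

    acts-τ : ∀ {c s t} → Acts c s t → Acts (τ c) t s
    acts-τ (move k p) = subst (Acts _ _) (σ-inv k _) (move (τᴷ k) (P-τ p))
    acts-τ (stay p)   = stay λ k q → p (τᴷ k) (subst (P (τᴷ k)) (τ-inv _) (P-τ q))

    run-functional : ∀ {u s t t′} → Run u s t → Run u s t′ → t ≡ t′
    run-functional []      []      = refl
    run-functional (x ∷ p) (y ∷ q) with refl ← acts-functional x y = run-functional p q

    run-total : ∀ u s → ¬ ¬ (∃[ t ] Run u s t)
    run-total []      s none = none (s , [])
    run-total (c ∷ u) s none = acts-total c s λ (t , x) →
      run-total u t λ (r , p) → none (r , x ∷ p)

    run-++⁺ : ∀ {u v s t r} → Run u s t → Run v t r → Run (u ++ v) s r
    run-++⁺ []      q = q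
    run-++⁺ (x ∷ p) q = x ∷ run-++⁺ p q

    run-++⁻ : ∀ u {v s r} → Run (u ++ v) s r → ∃[ t ] (Run u s t × Run v t r)
    run-++⁻ []      q       = _ , [] , q
    run-++⁻ (c ∷ u) (x ∷ q) with t , p , q ← run-++⁻ u q = t , x ∷ p , q

    -- Both directions are proved together because of `≃-sym`. The double negation enters where a
    -- cancelling pair is inserted: a state reached by `c` is known only through `acts-total`.
    run-≃ : ∀ {u v} → u ≃ v → (∀ {s t} → Run u s t → ¬ ¬ Run v s t) ×
                               (∀ {s t} → Run v s t → ¬ ¬ Run u s t)
    run-≃ ≃-refl        = contradiction , contradiction
    run-≃ (≃-sym e)     = proj₂ (run-≃ e) , proj₁ (run-≃ e)
    run-≃ (≃-trans e f) =
      (λ p ¬r → proj₁ (run-≃ e) p λ q → proj₁ (run-≃ f) q ¬r) ,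
      (λ p ¬r → proj₂ (run-≃ f) p λ q → proj₂ (run-≃ e) q ¬r)
    run-≃ (≃-cons c e)  =
      (λ { (x ∷ p) ¬r → proj₁ (run-≃ e) p λ q → ¬r (x ∷ q) }) ,
      (λ { (x ∷ p) ¬r → proj₂ (run-≃ e) p λ q → ¬r (x ∷ q) })
    run-≃ (cancel c u)  =
      (λ { (x ∷ y ∷ p) ¬r → ¬r (subst (λ s → Run u s _) (acts-functional y (acts-τ x)) p) }) ,
      (λ {s} p ¬r → acts-total c s λ (t , x) → ¬r (x ∷ acts-τ x ∷ p))

    -- Distinguishes elements of Π by their effect on one state. The doubly negated conclusion
    -- suffices for the negative and decidable goals it serves.
    ≃⇒≡ : ∀ {u v s t t′} → u ≃ v → Run u s t → Run v s t′ → ¬ t ≢ t′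
    ≃⇒≡ e p q t≢t′ = proj₁ (run-≃ e) p λ p → t≢t′ (run-functional p q)

    module _ (σ-comm : ∀ j k s → σ j (σ k s) ≡ σ k (σ j s)) where

      acts-comm : ∀ {c d s t r} → Acts c s t → Acts d t r → ∃[ t′ ] (Acts d s t′ × Acts c t′ r)
      acts-comm (move j p) (move k q) = _ , move k q , subst (Acts _ _) (σ-comm j k _) (move j p)
      acts-comm (move j p) (stay q)   = _ , stay q , move j p
      acts-comm (stay p)   (move k q) = _ , move k q , stay p
      acts-comm (stay p)   (stay q)   = _ , stay q , stay p

      run-↭ : ∀ {u v s t} → u ↭ v → Run u s t → Run v s t
      run-↭ Perm.refl          p           = p
      run-↭ (Perm.prep c e)    (x ∷ p)     = x ∷ run-↭ e p
      run-↭ (Perm.swap c d e)  (x ∷ y ∷ p) with _ , y , x ← acts-comm x y = y ∷ x ∷ run-↭ e p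
      run-↭ (Perm.trans e f)   p           = run-↭ f (run-↭ e p)

      -- A commutative action factors through the abelianisation of Π, where `γ u` becomes a product
      -- of cancelling pairs.
      run-γ : ∀ u {s t} → Run (γ u) s t → ¬ s ≢ t
      run-γ u p with cs , e ← γ-↭-pairs u =
        λ s≢t → ≃⇒≡ (pairs≃[] cs) (run-↭ e p) [] (s≢t ∘ sym)

    trace : List K → S → S
    trace []       s = s
    trace (k ∷ ks) s = trace ks (σ k s)

    trace-++ : ∀ ks ls s → trace (ks ++ ls) s ≡ trace ls (trace ks s)
    trace-++ []       ls s = refl
    trace-++ (k ∷ ks) ls s = trace-++ ks ls (σ k s)

    run-trace : ∀ {ks cs} s → Pointwise P ks cs → Run cs s (trace ks s)
    run-trace s []       = []
    run-trace s (p ∷ ps) = move _ p ∷ run-trace _ ps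

    doubleᴷ : List K → List K
    doubleᴷ ks = ks ++ map τᴷ ks

    run-double : ∀ {ks cs} s → Pointwise P ks cs →
                 Run (γ (double cs)) s (trace (doubleᴷ ks) s)
    run-double {cs = cs} s ps =
      subst (λ u → Run u s _) (sym (γ-double cs)) (run-trace s (PW.++⁺ ps (inverses ps)))
      where
      inverses : ∀ {ks cs} → Pointwise P ks cs → Pointwise P (map τᴷ ks) (map τ cs)
      inverses []       = []
      inverses (p ∷ ps) = P-τ p ∷ inverses ps

    double-noncommuting : ∀ {ks ls cs ds} s → Pointwise P ks cs → Pointwise P ls ds →
      trace (doubleᴷ ls) (trace (doubleᴷ ks) s) ≢ trace (doubleᴷ ks) (trace (doubleᴷ ls) s) →
      ¬ double cs · double ds ∼ double ds · double cs
    double-noncommuting {cs = cs} {ds} s ps qs ne e = ≃⇒≡ (γ-∼ e)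
      (subst (λ u → Run u s _) (sym (γ-· (double cs) (double ds)))
        (run-++⁺ (run-double s ps) (run-double _ qs)))
      (subst (λ u → Run u s _) (sym (γ-· (double ds) (double cs)))
        (run-++⁺ (run-double s qs) (run-double _ ps)))
      ne

  private
    module Orb = Setoid (Orbits τ τ-inv)

  SameOrbit-τ : ∀ {x c} → SameOrbit τ τ-inv x c → SameOrbit τ τ-inv x (τ c)
  SameOrbit-τ (inj₁ refl) = inj₂ refl
  SameOrbit-τ (inj₂ refl) = inj₁ (τ-inv _)

  -- A label and its image under `τ` get the same type, so the types must act by involutions.
  orbitLabelling : ∀ {n} → AtLeastOrbits τ τ-inv n → Labelling
  orbitLabelling {n} f = record
    { K      = Fin n
    ; P      = λ k c → SameOrbit τ τ-inv (Injection.to f k) c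
    ; τᴷ     = id
    ; unique = λ p q → Injection.injective f (Orb.trans p (Orb.sym q))
    ; P-τ    = SameOrbit-τ
    }

  -- Infinitude from the infinite dihedral group.

  module _ (f : AtLeastOrbits τ τ-inv 2) where
    open Injection f using (to)

    -- Two involutions of ℤ whose composite is n ↦ n + 1.
    reflection : Fin 2 → ℤ → ℤ
    reflection zero       (+ n)    = -[1+ n ]
    reflection zero       -[1+ n ] = + n
    reflection (suc zero) n        = - n

    reflection-involutive : ∀ k n → reflection k (reflection k n) ≡ n
    reflection-involutive zero       (+ n)    = refl
    reflection-involutive zero       -[1+ n ] = refl
    reflection-involutive (suc zero) n        = neg-involutive n

    open Action (orbitLabelling f) reflection reflection-involutive

    commutator : Nanoword
    commutator = double (to zero ∷ to (suc zero) ∷ [])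

    commutator^ : ℕ → Nanoword
    commutator^ zero    = ∅
    commutator^ (suc n) = commutator · commutator^ n

    -- Both types act by involutions, so one `commutator` acts as the square of the unit
    -- translation; hence the factor 2.
    run-commutator^ : ∀ n m → Run (γ (commutator^ n)) (+ m) (+ (n * 2 + m))
    run-commutator^ zero    m = []
    run-commutator^ (suc n) m =
      subst (λ u → Run u (+ m) (+ (suc n * 2 + m))) (sym (γ-· commutator (commutator^ n)))
        (run-++⁺ (run-double {zero ∷ suc zero ∷ []} (+ m) (Orb.refl ∷ Orb.refl ∷ []))
          (subst (λ k → Run (γ (commutator^ n)) (+ (2 + m)) (+ k)) eq
            (run-commutator^ n (2 + m))))
      where
      eq : n * 2 + (2 + m) ≡ suc n * 2 + m
      eq = trans (+-suc _ _) (cong suc (+-suc _ _))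

    infinite : Infinite (Group.setoid (𝒩c τ))
    infinite = record
      { to        = commutator^
      ; cong      = λ { refl → EqC.reflexive Step }
      ; injective = λ {m} {n} e → decidable-stable (m ≟ⁿ n) λ m≢n →
          ≃⇒≡ (γ-∼ e) (run-commutator^ m 0) (run-commutator^ n 0)
            (m≢n ∘ *-cancelʳ-≡ m n 2 ∘ +-cancelʳ-≡ 0 _ _ ∘ +-injective)
      }

  -- Non-commutativity for three orbits.

  module _ (f : AtLeastOrbits τ τ-inv 3) where
    open Injection f using (to)

    transposition : Fin 3 → Fin 4 → Fin 4
    transposition zero             zero                   = suc zero
    transposition zero             (suc zero)             = zero
    transposition (suc zero)       (suc zero)             = suc (suc zero)
    transposition (suc zero)       (suc (suc zero))       = suc zero
    transposition (suc (suc zero)) (suc (suc zero))       = suc (suc (suc zero))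
    transposition (suc (suc zero)) (suc (suc (suc zero))) = suc (suc zero)
    transposition _                i                      = i

    transposition-involutive : ∀ k i → transposition k (transposition k i) ≡ i
    transposition-involutive = toWitness {a? = all? λ k → all? λ i → _ ≟ᶠ _} tt

    open Action (orbitLabelling f) transposition transposition-involutive

    -- The two nanowords act as squares of products of neighbouring transpositions, namely as the
    -- 3-cycles (0 1 2) and (1 2 3). The two orders send 0 to 2 and to 1.
    nonAbelian₃ : NonAbelian (𝒩c τ)
    nonAbelian₃ = double (to zero ∷ to (suc zero) ∷ []) ,
                  double (to (suc zero) ∷ to (suc (suc zero)) ∷ []) ,
      double-noncommuting {zero ∷ suc zero ∷ []} {suc zero ∷ suc (suc zero) ∷ []} zero
        (Orb.refl ∷ Orb.refl ∷ []) (Orb.refl ∷ Orb.refl ∷ []) λ ()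

  -- Non-commutativity when `τ` moves a label.

  module _ {x y : α} (τx≢x : τ x ≢ x) (x≁y : ¬ SameOrbit τ τ-inv x y) where

    data Kind : Set where
      forward backward toggle : Kind

    inverse : Kind → Kind
    inverse forward  = backward
    inverse backward = forward
    inverse toggle   = toggle

    -- As `x` and `τ x` differ, they may act by mutually inverse maps of any order; the orbit of `y`
    -- acts by an involution.
    labelling : Labelling
    labelling = record { K = Kind ; P = P ; τᴷ = inverse ; unique = unique ; P-τ = P-τ }
      where
      P : Kind → α → Set a
      P forward  c = c ≡ x
      P backward c = c ≡ τ x
      P toggle   c = SameOrbit τ τ-inv y c

      unique : ∀ {j k c} → P j c → P k c → j ≡ k
      unique {forward}  {forward}  _ _    = refl
      unique {forward}  {backward} refl q = ⊥-elim (τx≢x (sym q))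
      unique {forward}  {toggle}   refl q = ⊥-elim (x≁y (Orb.sym q))
      unique {backward} {forward}  p refl = ⊥-elim (τx≢x (sym p))
      unique {backward} {backward} _ _    = refl
      unique {backward} {toggle}   p q    = ⊥-elim (x≁y (Orb.trans (inj₂ p) (Orb.sym q)))
      unique {toggle}   {forward}  p refl = ⊥-elim (x≁y (Orb.sym p))
      unique {toggle}   {backward} p q    = ⊥-elim (x≁y (Orb.trans (inj₂ q) (Orb.sym p)))
      unique {toggle}   {toggle}   _ _    = refl

      P-τ : ∀ {k c} → P k c → P (inverse k) (τ c)
      P-τ {forward}  refl = refl
      P-τ {backward} refl = τ-inv x
      P-τ {toggle}   p    = SameOrbit-τ p

    permutation : Kind → Fin 4 → Fin 4
    permutation forward  zero                   = suc zero
    permutation forward  (suc zero)             = suc (suc zero)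
    permutation forward  (suc (suc zero))       = suc (suc (suc zero))
    permutation forward  (suc (suc (suc zero))) = zero
    permutation backward zero                   = suc (suc (suc zero))
    permutation backward (suc i)                = inject₁ i
    permutation toggle   zero                   = suc zero
    permutation toggle   (suc zero)             = zero
    permutation toggle   i                      = i

    permutation-inverse : ∀ k i → permutation (inverse k) (permutation k i) ≡ i
    permutation-inverse forward  = toWitness {a? = all? λ i → _ ≟ᶠ _} tt
    permutation-inverse backward = toWitness {a? = all? λ i → _ ≟ᶠ _} tt
    permutation-inverse toggle   = toWitness {a? = all? λ i → _ ≟ᶠ _} tt

    private
      module Permutation = Action labelling permutation permutation-inverse

    -- The two nanowords act as (0 3 1) and (0 1)(2 3); the two orders send 0 to 2 and to 0.
    nonAbelian₂ : NonAbelian (𝒩c τ)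
    nonAbelian₂ = double (x ∷ y ∷ []) , double (x ∷ x ∷ y ∷ []) ,
      Permutation.double-noncommuting {forward ∷ toggle ∷ []} {forward ∷ forward ∷ toggle ∷ []} zero
        (refl ∷ Orb.refl ∷ []) (refl ∷ refl ∷ Orb.refl ∷ []) λ ()

    -- Infinite generation from the lamplighter group.

    translation : Kind → ℤ → ℤ
    translation forward  = sucℤ
    translation backward = pred
    translation toggle   = id

    translation-inverse : ∀ k h → translation (inverse k) (translation k h) ≡ h
    translation-inverse forward  h = pred-suc h
    translation-inverse backward h = suc-pred h
    translation-inverse toggle   h = refl

    translation-comm : ∀ j k h → translation j (translation k h) ≡ translation k (translation j h)
    translation-comm forward  forward  h = refl
    translation-comm forward  backward h = trans (suc-pred h) (sym (pred-suc h))
    translation-comm backward forward  h = trans (pred-suc h) (sym (suc-pred h))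
    translation-comm backward backward h = refl
    translation-comm toggle   k        h = refl
    translation-comm forward  toggle   h = refl
    translation-comm backward toggle   h = refl

    private
      module Position = Action labelling translation translation-inverse

    -- The lamplighter on ℤ, of whose configuration only the lamp at N is recorded.
    module Lamplighter (N : ℕ) where

      lamplighter : Kind → ℤ × Bool → ℤ × Bool
      lamplighter forward  (h , b) = sucℤ h , b
      lamplighter backward (h , b) = pred h , b
      lamplighter toggle   (h , b) = h , (if does (h ≟ᶻ + N) then not b else b)

      lamplighter-inverse : ∀ k s → lamplighter (inverse k) (lamplighter k s) ≡ s
      lamplighter-inverse forward  (h , b) = cong (_, b) (pred-suc h)
      lamplighter-inverse backward (h , b) = cong (_, b) (suc-pred h)
      lamplighter-inverse toggle   (h , b) with does (h ≟ᶻ + N)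
      ... | true  = cong (h ,_) (not-involutive b)
      ... | false = refl

      open Action labelling lamplighter lamplighter-inverse public

      acts-position : ∀ {c h b h′ b′} → Acts c (h , b) (h′ , b′) → Position.Acts c h h′
      acts-position (move forward p)  = Position.move forward p
      acts-position (move backward p) = Position.move backward p
      acts-position (move toggle p)   = Position.move toggle p
      acts-position (stay p)          = Position.stay p

      run-position : ∀ {u h b h′ b′} → Run u (h , b) (h′ , b′) → Position.Run u h h′
      run-position []      = Position.[]
      run-position (x ∷ p) = acts-position x Position.∷ run-position p

      -- Each generator moves the lamplighter at most one place to the right, so he never reaches
      -- `N`.
      run-short : ∀ {u n h b h′ b′} → h ≤ᶻ + n → n + length u < N →
                  Run u (h , b) (h′ , b′) → b′ ≡ b
      run-short h≤n len [] = refl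
      run-short {_ ∷ u} {n} h≤n len (move forward _ ∷ p) =
        run-short (suc-mono h≤n) (subst (_< N) (+-suc n (length u)) len) p
      run-short {_ ∷ u} {n} h≤n len (move backward _ ∷ p) =
        run-short (i≤j⇒pred[i]≤j h≤n) (≤-trans (s≤s (+-monoʳ-≤ n (n≤1+n _))) len) p
      run-short {_ ∷ u} {n} {h} {b} h≤n len (move toggle _ ∷ p) =
        trans (run-short h≤n (≤-trans (s≤s (+-monoʳ-≤ n (n≤1+n _))) len) p)
          (cong (if_then not b else b) (dec-false (h ≟ᶻ + N) λ { refl →
            <-irrefl refl (≤-trans (s≤s (≤-trans (drop‿+≤+ h≤n) (m≤m+n n _))) len) }))
      run-short {_ ∷ u} {n} h≤n len (stay _ ∷ p) =
        run-short h≤n (≤-trans (s≤s (+-monoʳ-≤ n (n≤1+n _))) len) p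

      -- Defines a subgroup that separates nanowords with short readings from `lampWord`. The double
      -- negation is inherited from `run-total`.
      Fixes : Nanoword → Set a
      Fixes u = ∀ b → ¬ ¬ Run (γ u) (+ 0 , b) (+ 0 , b)

      -- Translations commute, so `run-γ` brings the lamplighter back to 0, and `run-short` keeps
      -- the lamp unchanged.
      short⇒fixes : ∀ u → length (γ u) < N → Fixes u
      short⇒fixes u len b ¬r = run-total (γ u) (+ 0 , b) λ ((h , b′) , p) →
        Position.run-γ translation-comm u (run-position p) λ { refl →
          ¬r (subst (λ b′ → Run (γ u) (+ 0 , b) (+ 0 , b′)) (run-short ≤ᶻ-refl len p) p) }

      fixes-· : ∀ u v → Fixes u → Fixes v → Fixes (u · v)
      fixes-· u v p q b ¬r = p b λ p → q b λ q →
        ¬r (subst (λ w → Run w _ _) (sym (γ-· u v)) (run-++⁺ p q))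

      fixes-∼ : ∀ {u v} → u ∼ v → Fixes u → Fixes v
      fixes-∼ e p b ¬r = p b λ p → proj₁ (run-≃ (γ-∼ e)) p ¬r

      -- Avoids computing the reading of `u ⁻`: by invariance `u · u ⁻` acts trivially, and its run
      -- passes through the state to which `u` leads, which is the initial one.
      fixes-⁻ : ∀ u → Fixes u → Fixes (u ⁻)
      fixes-⁻ u p b ¬r = p b λ p → proj₂ (run-≃ (γ-∼ (·-inverseʳ u))) [] λ q →
        let _ , p′ , q′ = run-++⁻ (γ u) (subst (λ w → Run w _ _) (γ-· u (u ⁻)) q) in
        ¬r (subst (λ s → Run (γ (u ⁻)) s _) (run-functional p′ p) q′)

      fixes-⟨⟩ : ∀ {n} {g : Fin n → Nanoword} → (∀ i → Fixes (g i)) →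
                 ∀ {u} → ⟨_⟩ (𝒩c τ) g u → Fixes u
      fixes-⟨⟩ fix (gen i)            = fix i
      fixes-⟨⟩ fix unit               = λ b ¬r → ¬r []
      fixes-⟨⟩ fix (mul {u} {v} p q)  = fixes-· u v (fixes-⟨⟩ fix p) (fixes-⟨⟩ fix q)
      fixes-⟨⟩ fix (inv {u} p)        = fixes-⁻ u (fixes-⟨⟩ fix p)
      fixes-⟨⟩ fix (resp e p)         = fixes-∼ e (fixes-⟨⟩ fix p)

    module _ (n : ℕ) where
      -- One beyond `n`, so that readings of length at most `n` satisfy `short⇒fixes`.
      private N = suc n
      open Lamplighter N

      forward^ : ∀ m k b → trace (replicate m forward) (+ k , b) ≡ (+ (m + k) , b)
      forward^ zero    k b = refl
      forward^ (suc m) k b = trans (forward^ m (suc k) b) (cong (λ j → + j , b) (+-suc m k))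

      backward^ : ∀ m k b → trace (replicate m backward) (+ (m + k) , b) ≡ (+ k , b)
      backward^ zero    k b = refl
      backward^ (suc m) k b = backward^ m k b

      lampWord : Nanoword
      lampWord = double (replicate N x ++ [ y ])

      run-lampWord : Run (γ lampWord) (+ 0 , false) (+ 0 , true)
      run-lampWord = subst (Run (γ lampWord) _) eq
        (run-double {replicate N forward ++ [ toggle ]} (+ 0 , false)
          (PW.++⁺ (PW.replicate⁺ refl N) (Orb.refl ∷ [])))
        where
        open ≡-Reasoning
        F = replicate N forward
        B = replicate N backward
        eq : trace (doubleᴷ (F ++ [ toggle ])) (+ 0 , false) ≡ (+ 0 , true)
        eq = begin
          trace ((F ++ [ toggle ]) ++ map inverse (F ++ [ toggle ])) (+ 0 , false)
            ≡⟨ cong (λ ks → trace ((F ++ [ toggle ]) ++ ks) (+ 0 , false))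
                 (trans (map-++ inverse F _) (cong (_++ [ toggle ]) (map-replicate inverse N forward))) ⟩
          trace ((F ++ [ toggle ]) ++ B ++ [ toggle ]) (+ 0 , false)
            ≡⟨ trace-++ (F ++ [ toggle ]) _ (+ 0 , false) ⟩
          trace (B ++ [ toggle ]) (trace (F ++ [ toggle ]) (+ 0 , false))
            ≡⟨ cong (trace (B ++ [ toggle ])) (trace-++ F _ (+ 0 , false)) ⟩
          trace (B ++ [ toggle ]) (lamplighter toggle (trace F (+ 0 , false)))
            ≡⟨ cong (trace (B ++ [ toggle ]) ∘ lamplighter toggle)
                 (trans (forward^ N 0 false) (cong (λ j → + j , false) (+-identityʳ N))) ⟩
          trace (B ++ [ toggle ]) (lamplighter toggle (+ N , false))
            ≡⟨ cong (λ c → trace (B ++ [ toggle ]) (+ N , (if c then true else false)))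
                 (dec-true (+ N ≟ᶻ + N) refl) ⟩
          trace (B ++ [ toggle ]) (+ N , true)
            ≡⟨ trace-++ B _ (+ N , true) ⟩
          lamplighter toggle (trace B (+ N , true))
            ≡⟨ cong (lamplighter toggle) (trans
                 (cong (λ j → trace B (+ j , true)) (sym (+-identityʳ N))) (backward^ N 0 true)) ⟩
          -- The last toggle takes place at 0, away from the lamp since `N` is positive.
          (+ 0 , true) ∎

      ¬fixes-lampWord : ¬ Fixes lampWord
      ¬fixes-lampWord p = p false λ p → contradiction (run-functional p run-lampWord) λ ()

    -- With `b` bounding the lengths of the readings of all generators, `Fixes` for the lamp at
    -- `suc b` contains the generators but not `lampWord b`.
    notFinitelyGenerated : ¬ FinitelyGenerated (𝒩c τ)
    notFinitelyGenerated (n , g , generates) =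
      ¬fixes-lampWord b (fixes-⟨⟩ (λ i → short⇒fixes (g i) (s≤s (bound i))) (generates (lampWord b)))
      where
      lengths = map (length ∘ γ ∘ g) (allFin n)
      b = max 0 lengths
      open Lamplighter (suc b)
      bound : ∀ i → length (γ (g i)) ≤ b
      bound i = All.lookup (xs≤max 0 lengths) (∈-map⁺ (length ∘ γ ∘ g) (∈-allFin i))

  -- At least one of the two given orbits does not contain `x`. As the goal is a negation, both can
  -- be tried without deciding which.
  infinitelyGenerated : AtLeastOrbits τ τ-inv 2 → (∃[ x ] τ x ≢ x) → ¬ FinitelyGenerated (𝒩c τ)
  infinitelyGenerated f (x , τx≢x) fg =
    notFinitelyGenerated τx≢x (λ x~0 →
      notFinitelyGenerated τx≢x (λ x~1 →
        contradiction (Injection.injective f {zero} {suc zero} (Orb.trans (Orb.sym x~0) x~1)) λ ())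
        fg) fg

  -- Here witnesses are demanded, so a label outside the orbit of `x` must be exhibited;
  -- surjectivity finds the index of the orbit of `x`, and the other index provides the label.
  nonAbelian : AtLeastOrbits τ τ-inv 3 ⊎ (ExactlyOrbits τ τ-inv 2 × (∃[ x ] τ x ≢ x)) →
               NonAbelian (𝒩c τ)
  nonAbelian (inj₁ f)              = nonAbelian₃ f
  nonAbelian (inj₂ (f , x , τx≢x)) with Bijection.surjective f x
  ... | k , k~x = nonAbelian₂ τx≢x λ x~other →
    other≢ k (Bijection.injective f (Orb.trans (k~x refl) x~other))
    where
    other : Fin 2 → Fin 2
    other zero    = suc zero
    other (suc _) = zero
    other≢ : ∀ k → k ≢ other k
    other≢ zero       ()
    other≢ (suc zero) ()

theorem4p1p2 : ∀ {a : Level} {α : Set a} (τ : α → α) (τ-inv : Involutive _≡_ τ) →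
    (AtLeastOrbits τ τ-inv 2 → Infinite (Group.setoid (𝒩c τ)))
    × (AtLeastOrbits τ τ-inv 2 → (∃[ x ] τ x ≢ x) → ¬ FinitelyGenerated (𝒩c τ))
    × (AtLeastOrbits τ τ-inv 3 ⊎ (ExactlyOrbits τ τ-inv 2 × (∃[ x ] τ x ≢ x)) → NonAbelian (𝒩c τ))
theorem4p1p2 τ τ-inv = infinite , infinitelyGenerated , nonAbelian
  where open Invariant τ τ-inv
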